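{- Disjoint Paths can be solved in $O(2^n n^2 k)$ time, where $n$ is the number of vertices of the input graph and $k$ the number of terminal pairs.
   Context: Disjoint Paths: given a graph $G$ and pairwise disjoint terminal pairs $(s_1,t_1),\dots,(s_k,t_k)$ (all $2k$ vertices distinct), decide whether $G$ has pairwise vertex-disjoint paths $P^1,\dots,P^k$ with $P^i$ an $s_i$–$t_i$ path. -}

module Defs where

open import Data.Bool.Base using (Bool; true; false; T; if_then_else_)
open import Data.Fin.Base using (Fin; toℕ)
open import Data.List.Base using (List; []; _∷_; _++_; concatMap; map; allFin; head; last)
open import Data.List.Relation.Binary.Disjoint.Propositional using (Disjoint)
open import Data.List.Relation.Unary.Linked using (Linked)
open import Data.List.Relation.Unary.Unique.Propositional using (Unique)
open import Data.Maybe.Base using (just)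
open import Data.Nat.Base using (ℕ; zero; suc; _+_; _*_; _∸_; _^_; _⊔_; _≤_; _<_; _≡ᵇ_; _<ᵇ_)
import Data.Nat.DivMod as ℕ
open import Data.Product.Base using (Σ-syntax; ∃-syntax; _×_)
open import Data.Sum.Base using (_⊎_)
open import Function.Definitions using (Injective)
open import Relation.Binary.PropositionalEquality.Core using (_≡_; _≢_)
open import Relation.Nullary.Negation.Core using (¬_)

-- Word RAM, with programs in structured (while) form.
--
-- Unit cost per instruction and per evaluated test.  The word length w
-- is a parameter of the semantics: an instruction whose result does not
-- fit in w bits has no transition, so a halting run never overflows.

Reg : Set
Reg = ℕ

data Op : Set where
  add sub mul div mod : Op

-- Subtraction is truncated; division and remainder by 0 give 0.
⟦_⟧ᵒ : Op → ℕ → ℕ → ℕ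
⟦ add ⟧ᵒ a b       = a + b
⟦ sub ⟧ᵒ a b       = a ∸ b
⟦ mul ⟧ᵒ a b       = a * b
⟦ div ⟧ᵒ a zero    = 0
⟦ div ⟧ᵒ a (suc b) = a ℕ./ suc b
⟦ mod ⟧ᵒ a zero    = 0
⟦ mod ⟧ᵒ a (suc b) = a ℕ.% suc b

data Cmp : Set where
  eq lt : Cmp

⟦_⟧ᶜ : Cmp → ℕ → ℕ → Bool
⟦ eq ⟧ᶜ = _≡ᵇ_
⟦ lt ⟧ᶜ = _<ᵇ_

data Test : Set where
  test : Cmp → Reg → Reg → Test

infixr 4 _⨾_

data Program : Set where
  skip   : Program
  const  : (x : Reg) (a : ℕ) → Program               -- x := a
  move   : (x y : Reg) → Program                     -- x := y
  arith  : (x : Reg) (o : Op) (y z : Reg) → Program  -- x := y o z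
  load   : (x y : Reg) → Program                     -- x := M[y]
  store  : (x y : Reg) → Program                     -- M[x] := y
  _⨾_    : Program → Program → Program
  ifElse : Test → Program → Program → Program
  while  : Test → Program → Program

record State : Set where
  constructor ⟨_,_⟩
  field
    reg : ℕ → ℕ
    mem : ℕ → ℕ

open State public

_[_↦_] : (ℕ → ℕ) → ℕ → ℕ → (ℕ → ℕ)
(f [ x ↦ a ]) y = if y ≡ᵇ x then a else f y

setReg setMem : ℕ → ℕ → State → State
setReg x a σ = ⟨ reg σ [ x ↦ a ] , mem σ ⟩
setMem x a σ = ⟨ reg σ , mem σ [ x ↦ a ] ⟩

⟦_⟧ᵗ : Test → State → Bool
⟦ test c x y ⟧ᵗ σ = ⟦ c ⟧ᶜ (reg σ x) (reg σ y)

-- w ⊢ p , σ ⇓[ t ] τ : with w-bit words, p started in σ halts in τ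
-- after exactly t steps.
data _⊢_,_⇓[_]_ (w : ℕ) : Program → State → ℕ → State → Set where

  skip : ∀ {σ} → w ⊢ skip , σ ⇓[ 1 ] σ

  const : ∀ {σ x a} → a < 2 ^ w →
          w ⊢ const x a , σ ⇓[ 1 ] setReg x a σ

  move : ∀ {σ x y} → reg σ y < 2 ^ w →
         w ⊢ move x y , σ ⇓[ 1 ] setReg x (reg σ y) σ

  arith : ∀ {σ x o y z} → ⟦ o ⟧ᵒ (reg σ y) (reg σ z) < 2 ^ w →
          w ⊢ arith x o y z , σ ⇓[ 1 ] setReg x (⟦ o ⟧ᵒ (reg σ y) (reg σ z)) σ

  load : ∀ {σ x y} → mem σ (reg σ y) < 2 ^ w →
         w ⊢ load x y , σ ⇓[ 1 ] setReg x (mem σ (reg σ y)) σ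

  store : ∀ {σ x y} →
          w ⊢ store x y , σ ⇓[ 1 ] setMem (reg σ x) (reg σ y) σ

  seq : ∀ {σ τ υ p q t u} →
        w ⊢ p , σ ⇓[ t ] τ → w ⊢ q , τ ⇓[ u ] υ →
        w ⊢ p ⨾ q , σ ⇓[ t + u ] υ

  if-true : ∀ {σ τ b p q t} → ⟦ b ⟧ᵗ σ ≡ true →
            w ⊢ p , σ ⇓[ t ] τ →
            w ⊢ ifElse b p q , σ ⇓[ 1 + t ] τ

  if-false : ∀ {σ τ b p q t} → ⟦ b ⟧ᵗ σ ≡ false →
             w ⊢ q , σ ⇓[ t ] τ →
             w ⊢ ifElse b p q , σ ⇓[ 1 + t ] τ

  while-true : ∀ {σ τ υ b p t u} → ⟦ b ⟧ᵗ σ ≡ true →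
               w ⊢ p , σ ⇓[ t ] τ → w ⊢ while b p , τ ⇓[ u ] υ →
               w ⊢ while b p , σ ⇓[ 1 + (t + u) ] υ

  while-false : ∀ {σ b p} → ⟦ b ⟧ᵗ σ ≡ false →
                w ⊢ while b p , σ ⇓[ 1 ] σ

-- Memory holding the given list from address 0 on, and 0 elsewhere.
memory : List ℕ → ℕ → ℕ
memory []       _       = 0
memory (a ∷ as) zero    = a
memory (a ∷ as) (suc i) = memory as i

initial : List ℕ → State
initial input = ⟨ (λ _ → 0) , memory input ⟩

record Problem : Set₁ where
  field
    Instance : Set
    size     : Instance → ℕ
    encode   : Instance → List ℕ
    Yes      : Instance → Set

-- The answer is read off register 0: 1 for yes, 0 for no.
Answers : Set → State → Set
Answers A σ = (reg σ 0 ≡ 1 × A) ⊎ (reg σ 0 ≡ 0 × ¬ A)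

-- A single program solves every instance I in O(f I) steps, on words of
-- O(size I) bits.  The 1 ⊔_ matters only where f I is 0: there the run,
-- which cannot take 0 steps, must take constant time.
SolvableInTimeO : (P : Problem) → (Problem.Instance P → ℕ) → Set
SolvableInTimeO P f =
  Σ[ p ∈ Program ] ∃[ c ] ∃[ C ] ((I : Instance) →
    ∃[ t ] ∃[ σ ]
      (c * suc (size I)) ⊢ p , initial (encode I) ⇓[ t ] σ
      × t ≤ C * (1 ⊔ f I)
      × Answers (Yes I) σ)
  where open Problem P

record Graph (n : ℕ) : Set where
  field
    adj    : Fin n → Fin n → Bool
    sym    : ∀ u v → adj u v ≡ adj v u
    irrefl : ∀ v → adj v v ≡ false

  Adj : Fin n → Fin n → Set
  Adj u v = T (adj u v)

record Path {n : ℕ} (G : Graph n) (s t : Fin n) : Set where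
  field
    vertices : List (Fin n)
    starts   : head vertices ≡ just s
    ends     : last vertices ≡ just t
    linked   : Linked (Graph.Adj G) vertices
    unique   : Unique vertices

record DisjointPathsInstance : Set where
  field
    n k         : ℕ
    graph       : Graph n
    s t         : Fin k → Fin n
    s-injective : Injective _≡_ _≡_ s
    t-injective : Injective _≡_ _≡_ t
    s≢t         : ∀ i j → s i ≢ t j

module _ (I : DisjointPathsInstance) where
  open DisjointPathsInstance I

  HasDisjointPaths : Set
  HasDisjointPaths =
    Σ[ P ∈ ((i : Fin k) → Path graph (s i) (t i)) ]
      (∀ i j → i ≢ j → Disjoint (Path.vertices (P i)) (Path.vertices (P j)))

  -- n, k, s₁, t₁, …, s_k, t_k, then the adjacency matrix row by row.
  encodeInstance : List ℕ
  encodeInstance =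
    n ∷ k ∷ concatMap (λ i → toℕ (s i) ∷ toℕ (t i) ∷ []) (allFin k)
      ++ concatMap (λ u → map (λ v → if Graph.adj graph u v then 1 else 0) (allFin n)) (allFin n)

DisjointPaths : Problem
DisjointPaths = record
  { Instance = DisjointPathsInstance
  ; size     = DisjointPathsInstance.n
  ; encode   = encodeInstance
  ; Yes      = HasDisjointPaths
  }

{-# OPTIONS --safe #-}
module Submission where

-- Dynamic programming over triples (S, i, u): S is the set of vertices used so
-- far (as a bit mask), the paths before the i-th are complete, and the i-th one
-- currently ends at u.  A triple is extended by an unused neighbour v of u, or,
-- when u completes the i-th path, by the first vertex v of the next one.  All
-- 2ⁿ · k · n · n combinations of a triple and a vertex v are tried in a single
-- loop, in the order of the number ((S k + i) n + u) n + v; since S only grows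
-- along a transition, a triple is settled before the loop reaches it.

open import Defs
open import Data.Bool.Base using (Bool; true; false; T; if_then_else_)
open import Data.Fin.Base using (Fin; zero; suc; toℕ; fromℕ<)
open import Data.Fin.Properties using (toℕ<n; toℕ-injective; toℕ-fromℕ<; injective⇒≤) renaming (_≟_ to _≟ᶠ_)
open import Data.List.Base using (List; []; _∷_; _++_; length; map; concatMap; allFin; tabulate; head; last)
open import Data.List.Membership.Propositional using (_∈_; _∉_)
open import Data.List.Properties using (length-++; length-map; length-tabulate; map-tabulate)
open import Data.List.Relation.Binary.Disjoint.Propositional using (Disjoint)
open import Data.List.Relation.Unary.All using (All; []; _∷_)
import Data.List.Relation.Unary.All.Properties as All
open import Data.List.Relation.Unary.Any using (here; there)
open import Data.List.Relation.Unary.Linked using (Linked; [-]; _∷_)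
open import Data.List.Relation.Unary.Unique.Propositional using (Unique; []; _∷_)
open import Data.Maybe.Base using (just)
open import Data.Maybe.Properties using (just-injective)
open import Data.Nat.Base using (ℕ; zero; suc; pred; _+_; _*_; _^_; _⊔_; _≤_; _<_; _≤ᵇ_; _≡ᵇ_; z≤n; s≤s; z<s; s<s; NonZero; ≢-nonZero; >-nonZero; >-nonZero⁻¹)
open import Data.Nat.Divisibility using (m∣m*n)
open import Data.Nat.DivMod hiding (_div_; _mod_)
open import Data.Nat.Properties
open import Data.Nat.Tactic.RingSolver using (solve-∀)
open import Data.Product.Base using (∃-syntax; _×_; _,_; proj₁; proj₂)
open import Data.Sum.Base using (_⊎_; inj₁; inj₂)
open import Data.Unit.Base using (⊤; tt)
open import Data.Vec.Functional using (updateAt)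
open import Data.Vec.Functional.Properties using (updateAt-updates; updateAt-minimal)
open import Function.Base using (_$_; _∘_; id)
open import Relation.Binary.Definitions using (tri<; tri≈; tri>)
open import Relation.Binary.PropositionalEquality
open import Relation.Nullary.Decidable using (Dec; yes; no; does; dec-true; dec-false)
open import Relation.Nullary.Negation using (¬_; contradiction)

-- Bit masks

-- Each round must take constant time on a machine without bit operations. A round therefore decodes
-- its own number by division and remainder, reads membership of `v` in `S` as `S / 2 ^ v % 2` with
-- the power taken from a table, and inserts `v` by addition, which is carry-free because the bit
-- was found to be 0. The table of triples is never cleared: memory past the input starts at 0.
--
-- One mark per triple suffices because the set of used vertices alone decides whether a vertex may
-- be added; which path uses a vertex is irrelevant. The loop invariant has two halves: every mark
-- comes from a reachable triple (`Correct`), and every transition tried so far has left its mark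
-- (`Complete`). Together they show that a cell, when its round comes, is marked exactly if its
-- triple is reachable.
--
-- The degenerate case shapes the program: without pairs the time allowed is constant although `n`
-- is arbitrary, so `k` is tested before any loop over the vertices. With pairs, `n` is positive and
-- is absorbed by the main term.

bit : ℕ → ℕ → ℕ
bit zero    S = S % 2
bit (suc v) S = bit v (S / 2)

bit-zero : ∀ v → bit v 0 ≡ 0
bit-zero zero    = refl
bit-zero (suc v) = bit-zero v

-- The left-hand side is how the program reads a bit. Dividing by `2 ^ suc v` is halving first and
-- then dividing by `2 ^ v`, which is the recursion of `bit`.
/2^-%2 : ∀ v S .{{_ : NonZero (2 ^ v)}} → S / 2 ^ v % 2 ≡ bit v S
/2^-%2 zero    S = cong (_% 2) (n/1≡n S)
/2^-%2 (suc v) S = trans (cong (_% 2) (sym (m/n/o≡m/[n*o] S 2 (2 ^ v)))) (/2^-%2 v (S / 2))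
  where instance _ = m^n≢0 2 v

+-2*-/2 : ∀ S a → (S + 2 * a) / 2 ≡ S / 2 + a
+-2*-/2 S a = trans (+-distrib-/-∣ʳ S (m∣m*n a))
                    (cong (S / 2 +_) (trans (cong (_/ 2) (*-comm 2 a)) (m*n/n≡m a 2)))

+1-/2 : ∀ S → S % 2 ≡ 0 → (S + 1) / 2 ≡ S / 2
+1-/2 S even = trans (+-distrib-/ S 1 (subst (λ r → r + 1 < 2) (sym even) (n<1+n 1)))
                     (+-identityʳ (S / 2))

-- At a position holding 0 the addition of `2 ^ v` produces no carry; this is why `+` can serve as
-- insertion into a set.
bit-+-same : ∀ v S → bit v S ≡ 0 → bit v (S + 2 ^ v) ≡ 1
bit-+-same zero    S free = trans (%-distribˡ-+ S 1 2) (cong (λ r → (r + 1) % 2) free)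
bit-+-same (suc v) S free = trans (cong (bit v) (+-2*-/2 S (2 ^ v))) (bit-+-same v (S / 2) free)

bit-+-other : ∀ u v S → u ≢ v → bit u S ≡ 0 → bit v (S + 2 ^ u) ≡ bit v S
bit-+-other zero    zero    S u≢v _    = contradiction refl u≢v
bit-+-other zero    (suc v) S _   free = cong (bit v) (+1-/2 S free)
bit-+-other (suc u) zero    S _   _    = %-remove-+ʳ S (m∣m*n (2 ^ u))
bit-+-other (suc u) (suc v) S u≢v free =
  trans (cong (bit v) (+-2*-/2 S (2 ^ u))) (bit-+-other u v (S / 2) (λ u≡v → u≢v (cong suc u≡v)) free)

/2-cancel-< : ∀ {x y} → x / 2 < y → x < 2 * y
/2-cancel-< {x} {y} x/2<y = begin-strict
  x                  ≡⟨ m≡m%n+[m/n]*n x 2 ⟩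
  x % 2 + x / 2 * 2  <⟨ +-monoˡ-< (x / 2 * 2) (m%n<n x 2) ⟩
  suc (x / 2) * 2    ≤⟨ *-monoˡ-≤ 2 x/2<y ⟩
  y * 2              ≡⟨ *-comm y 2 ⟩
  2 * y              ∎
  where open ≤-Reasoning

/2-mono-< : ∀ {x y} → x < 2 * y → x / 2 < y
/2-mono-< {x} {y} x<2y = m<n*o⇒m/o<n (subst (x <_) (*-comm 2 y) x<2y)

-- Again no carry, so nothing spills past position `m`: halving lowers `v` and `m` together until
-- the free bit is the lowest one.
+2^-< : ∀ {v m S} → v < m → bit v S ≡ 0 → S < 2 ^ m → S + 2 ^ v < 2 ^ m
+2^-< {zero}  {suc m} {S} _         free S< =
  /2-cancel-< (subst (_< 2 ^ m) (sym (+1-/2 S free)) (/2-mono-< S<))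
+2^-< {suc v} {suc m} {S} (s<s v<m) free S< =
  /2-cancel-< (subst (_< 2 ^ m) (sym (+-2*-/2 S (2 ^ v))) (+2^-< v<m free (/2-mono-< S<)))

-- Reachable triples and disjoint paths

module Search (I : DisjointPathsInstance) where
  open DisjointPathsInstance I
  open Graph graph using (Adj)

  -- Paths are grown backwards, from tᵢ towards sᵢ, so that a new vertex is
  -- the head of its vertex list.
  data Reach : ℕ → Fin k → Fin n → Set where
    start  : ∀ {i} → toℕ i ≡ 0 → Reach (2 ^ toℕ (t i)) i (t i)
    extend : ∀ {S i u v} → Reach S i u → bit (toℕ v) S ≡ 0 → Adj v u →
             Reach (S + 2 ^ toℕ v) i v
    jump   : ∀ {S i j} → Reach S i (s i) → toℕ j ≡ suc (toℕ i) → bit (toℕ (t j)) S ≡ 0 →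
             Reach (S + 2 ^ toℕ (t j)) j (t j)

  Accepting : Set
  Accepting = ∃[ S ] ∃[ i ] suc (toℕ i) ≡ k × Reach S i (s i)

  Reach-< : ∀ {S i u} → Reach S i u → S < 2 ^ n
  Reach-< (start {i} _)            = ^-monoʳ-< 2 (n<1+n 1) (toℕ<n (t i))
  Reach-< (extend {v = v} r free _) = +2^-< (toℕ<n v) free (Reach-< r)
  Reach-< (jump {j = j} r _ free)  = +2^-< (toℕ<n (t j)) free (Reach-< r)

  IsPath : List (Fin n) → Fin n → Fin n → Set
  IsPath xs u v = head xs ≡ just u × last xs ≡ just v × Linked Adj xs × Unique xs

  -- The family of paths that a reachable triple stands for. The mask is tied to it by inclusion
  -- only: a bit 0 certifies that a vertex lies on no list, which is what freshness of the next
  -- vertex requires.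
  record Partial (S : ℕ) (i : Fin k) (u : Fin n) : Set where
    field
      P        : Fin k → List (Fin n)
      earlier  : ∀ j → toℕ j < toℕ i → IsPath (P j) (s j) (t j)
      current  : IsPath (P i) u (t i)
      later    : ∀ j → toℕ i < toℕ j → P j ≡ []
      disjoint : ∀ j j′ → j ≢ j′ → Disjoint (P j) (P j′)
      masked   : ∀ j {v} → v ∈ P j → bit (toℕ v) S ≡ 1

  module _ (P : Fin k → List (Fin n)) (i : Fin k) (v : Fin n) where

    push : Fin k → List (Fin n)
    push = updateAt P i (v ∷_)

    push-here : push i ≡ v ∷ P i
    push-here = updateAt-updates i P

    push-there : ∀ {j} → j ≢ i → push j ≡ P j
    push-there j≢i = updateAt-minimal _ i P j≢i

    ∈-push : ∀ j {x} → x ∈ push j → x ∈ P j ⊎ (j ≡ i × x ≡ v)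
    ∈-push j {x} x∈ with j ≟ᶠ i
    ... | no j≢i = inj₁ (subst (x ∈_) (push-there j≢i) x∈)
    ... | yes refl with subst (x ∈_) push-here x∈
    ...   | here x≡v  = inj₂ (refl , x≡v)
    ...   | there x∈P = inj₁ x∈P

    push-disjoint : (∀ j → v ∉ P j) → (∀ j j′ → j ≢ j′ → Disjoint (P j) (P j′)) →
                    ∀ j j′ → j ≢ j′ → Disjoint (push j) (push j′)
    push-disjoint fresh disj j j′ j≢j′ (x∈ , x∈′) with ∈-push j x∈ | ∈-push j′ x∈′
    ... | inj₁ x∈P          | inj₁ x∈P′         = disj j j′ j≢j′ (x∈P , x∈P′)
    ... | inj₁ x∈P          | inj₂ (_ , refl)   = fresh j x∈P
    ... | inj₂ (_ , refl)   | inj₁ x∈P′         = fresh j′ x∈P′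
    ... | inj₂ (refl , _)   | inj₂ (refl , _)   = j≢j′ refl

    push-masked : ∀ {S} → bit (toℕ v) S ≡ 0 → (∀ j {x} → x ∈ P j → bit (toℕ x) S ≡ 1) →
                  ∀ j {x} → x ∈ push j → bit (toℕ x) (S + 2 ^ toℕ v) ≡ 1
    push-masked {S} free masked j {x} x∈ with ∈-push j x∈
    ... | inj₂ (_ , refl) = bit-+-same (toℕ v) S free
    ... | inj₁ x∈P = trans (bit-+-other (toℕ v) (toℕ x) S v≢x free) (masked j x∈P)
      where v≢x : toℕ v ≢ toℕ x
            v≢x v≡x with trans (sym free) (trans (cong (λ y → bit y S) v≡x) (masked j x∈P))
            ... | ()

  masked⇒∉ : ∀ {S} {v : Fin n} {xs} → bit (toℕ v) S ≡ 0 → (∀ {x} → x ∈ xs → bit (toℕ x) S ≡ 1) → v ∉ xs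
  masked⇒∉ free masked v∈ with trans (sym free) (masked v∈)
  ... | ()

  ∷-linked : ∀ {u v xs} → Adj v u → head xs ≡ just u → Linked Adj xs → Linked Adj (v ∷ xs)
  ∷-linked {xs = x ∷ xs} v~u refl linked = v~u ∷ linked

  ∷-last : ∀ {A : Set} {u v w : A} {xs} → head xs ≡ just u → last xs ≡ just w → last (v ∷ xs) ≡ just w
  ∷-last {xs = _ ∷ _} _ last≡ = last≡

  ∷-isPath : ∀ {u v w xs} → Adj v u → v ∉ xs → IsPath xs u w → IsPath (v ∷ xs) v w
  ∷-isPath v~u v∉xs (head≡ , last≡ , linked , unique) =
    refl , ∷-last head≡ last≡ , ∷-linked v~u head≡ linked , All.¬Any⇒All¬ _ v∉xs ∷ unique

  -- Every constructor is one `push` of a fresh vertex. `start` is the push of `t i` onto the empty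
  -- family with mask 0, and `jump` pushes onto a list that `later` shows to be still empty.
  Reach⇒Partial : ∀ {S i u} → Reach S i u → Partial S i u
  Reach⇒Partial (start {i} i≡0) = record
    { P        = push empty i (t i)
    ; earlier  = λ j j<i → contradiction (subst (toℕ j <_) i≡0 j<i) n≮0
    ; current  = subst (λ xs → IsPath xs (t i) (t i)) (sym (push-here empty i (t i)))
                       (refl , refl , [-] , [] ∷ [])
    ; later    = λ j i<j → push-there empty i (t i) (λ { refl → <-irrefl refl i<j })
    ; disjoint = push-disjoint empty i (t i) (λ _ ()) (λ { _ _ _ (() , _) })
    ; masked   = push-masked empty i (t i) {0} (bit-zero (toℕ (t i))) (λ _ ())
    }
    where
      empty : Fin k → List (Fin n)
      empty _ = []
  Reach⇒Partial (extend {S} {i} {u} {v} r free v~u) = record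
    { P        = push P i v
    ; earlier  = λ j j<i → subst (λ xs → IsPath xs (s j) (t j))
                   (sym (push-there P i v (λ { refl → <-irrefl refl j<i }))) (earlier j j<i)
    ; current  = subst (λ xs → IsPath xs v (t i)) (sym (push-here P i v))
                   (∷-isPath v~u (fresh i) current)
    ; later    = λ j i<j → trans (push-there P i v (λ { refl → <-irrefl refl i<j })) (later j i<j)
    ; disjoint = push-disjoint P i v fresh disjoint
    ; masked   = push-masked P i v free masked
    }
    where
      open Partial (Reach⇒Partial r)
      fresh : ∀ j → v ∉ P j
      fresh j = masked⇒∉ {S} free (masked j)
  Reach⇒Partial (jump {S} {i} {j} r j≡1+i free) = record
    { P        = push P j (t j)
    ; earlier  = λ l l<j → subst (λ xs → IsPath xs (s l) (t l))
                   (sym (push-there P j (t j) (λ { refl → <-irrefl refl l<j }))) (before l l<j)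
    ; current  = subst (λ xs → IsPath xs (t j) (t j)) (sym (push-here P j (t j)))
                   (subst (λ xs → IsPath (t j ∷ xs) (t j) (t j)) (sym (later j i<j))
                     (refl , refl , [-] , [] ∷ []))
    ; later    = λ l j<l → trans (push-there P j (t j) (λ { refl → <-irrefl refl j<l }))
                                 (later l (<-trans i<j j<l))
    ; disjoint = push-disjoint P j (t j) (λ l → masked⇒∉ {S} free (masked l)) disjoint
    ; masked   = push-masked P j (t j) free masked
    }
    where
      open Partial (Reach⇒Partial r)
      i<j : toℕ i < toℕ j
      i<j = subst (toℕ i <_) (sym j≡1+i) (n<1+n (toℕ i))
      -- The pairs before `j` are those before `i` and `i` itself, whose path is complete because
      -- the triple stands at `s i`.
      before : ∀ l → toℕ l < toℕ j → IsPath (P l) (s l) (t l)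
      before l l<j with <-cmp (toℕ l) (toℕ i)
      ... | tri< l<i _ _ = earlier l l<i
      ... | tri≈ _ l≡i _ rewrite toℕ-injective l≡i = current
      ... | tri> _ _ i<l = contradiction (subst (toℕ l <_) j≡1+i l<j) (≤⇒≯ i<l)

  accepting⇒paths : Accepting → HasDisjointPaths I
  accepting⇒paths (S , i , 1+i≡k , r) = (λ j → toPath (isPath j)) , disjoint
    where
      open Partial (Reach⇒Partial r)
      isPath : ∀ j → IsPath (P j) (s j) (t j)
      isPath j with <-cmp (toℕ j) (toℕ i)
      ... | tri< j<i _ _ = earlier j j<i
      ... | tri≈ _ j≡i _ rewrite toℕ-injective j≡i = current
      ... | tri> _ _ i<j = contradiction (subst (toℕ j <_) (sym 1+i≡k) (toℕ<n j)) (≤⇒≯ i<j)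
      toPath : ∀ {xs u v} → IsPath xs u v → Path graph u v
      toPath {xs} (head≡ , last≡ , linked , unique) = record
        { vertices = xs ; starts = head≡ ; ends = last≡ ; linked = linked ; unique = unique }

  -- The recursion descends to `t i` and adds the vertices on the way back, in the direction of
  -- `extend`. The final mask stays existential; what is recorded is that vertices off the list
  -- remain free, as the next vertex and the next path need it.
  grow : ∀ {S₀ i} → Reach (S₀ + 2 ^ toℕ (t i)) i (t i) → ∀ x xs →
         last (x ∷ xs) ≡ just (t i) → Linked Adj (x ∷ xs) → Unique (x ∷ xs) →
         (∀ {v} → v ∈ x ∷ xs → bit (toℕ v) S₀ ≡ 0) →
         ∃[ S ] Reach S i x × (∀ {v} → v ∉ x ∷ xs → bit (toℕ v) S₀ ≡ 0 → bit (toℕ v) S ≡ 0)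
  grow {S₀} {i} base x [] last≡ _ _ free with just-injective last≡
  ... | refl = _ , base , λ {v} v∉ v-free →
        trans (bit-+-other (toℕ x) (toℕ v) S₀ (λ x≡v → v∉ (here (sym (toℕ-injective x≡v)))) (free (here refl)))
              v-free
  grow {S₀} {i} base x (y ∷ ys) last≡ (x~y ∷ linked) (x≢ ∷ unique) free
    with grow base y ys last≡ linked unique (λ v∈ → free (there v∈))
  ... | S , r , kept = _ , extend r x-free x~y , λ {v} v∉ v-free →
        trans (bit-+-other (toℕ x) (toℕ v) S (λ x≡v → v∉ (here (sym (toℕ-injective x≡v)))) x-free)
              (kept (λ v∈ → v∉ (there v∈)) v-free)
    where x-free : bit (toℕ x) S ≡ 0
          x-free = kept (All.All¬⇒¬Any x≢) (free (here refl))

  grow-path : ∀ {S₀ i} → Reach (S₀ + 2 ^ toℕ (t i)) i (t i) → (p : Path graph (s i) (t i)) →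
              (∀ {v} → v ∈ Path.vertices p → bit (toℕ v) S₀ ≡ 0) →
              ∃[ S ] Reach S i (s i) ×
                (∀ {v} → v ∉ Path.vertices p → bit (toℕ v) S₀ ≡ 0 → bit (toℕ v) S ≡ 0)
  grow-path base record { vertices = x ∷ xs ; starts = refl ; ends = ends ; linked = linked ; unique = unique } =
    grow base x xs ends linked unique

  last∈ : ∀ {A : Set} {v : A} xs → last xs ≡ just v → v ∈ xs
  last∈ (x ∷ [])     refl  = here refl
  last∈ (x ∷ y ∷ xs) last≡ = there (last∈ (y ∷ xs) last≡)

  module _ (paths : HasDisjointPaths I) where

    private
      P    = proj₁ paths
      disj = proj₂ paths

    -- Induction on the number of the pair: once the earlier paths are traced, disjointness leaves
    -- every vertex of the next path free, its last vertex `t j` included, so that `jump` applies.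
    reach-path : ∀ m i → toℕ i ≡ m → ∃[ S ] Reach S i (s i) ×
      (∀ {v} → (∀ j → toℕ j ≤ m → v ∉ Path.vertices (P j)) → bit (toℕ v) S ≡ 0)
    reach-path zero i i≡0 with grow-path {0} (start i≡0) (P i) (λ {v} _ → bit-zero (toℕ v))
    ... | S , r , kept = S , r , λ {v} v∉ → kept (v∉ i (≤-reflexive i≡0)) (bit-zero (toℕ v))
    reach-path (suc m) j j≡1+m = S , r , λ v∉ → kept (v∉ j (≤-reflexive j≡1+m))
                                                     (kept₀ (λ l l≤m → v∉ l (m≤n⇒m≤1+n l≤m)))
      where
        m<k : m < k
        m<k = <-trans (subst (m <_) (sym j≡1+m) (n<1+n m)) (toℕ<n j)
        i : Fin k
        i = fromℕ< m<k
        previous = reach-path m i (toℕ-fromℕ< m<k)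
        kept₀ = proj₂ (proj₂ previous)
        free : ∀ {v} → v ∈ Path.vertices (P j) → bit (toℕ v) (proj₁ previous) ≡ 0
        free v∈ = kept₀ (λ l l≤m v∈′ → disj l j (λ { refl → <-irrefl j≡1+m (s≤s l≤m) }) (v∈′ , v∈))
        base = jump (proj₁ (proj₂ previous)) (trans j≡1+m (cong suc (sym (toℕ-fromℕ< m<k))))
                    (free (last∈ _ (Path.ends (P j))))
        grown = grow-path base (P j) free
        S = proj₁ grown
        r = proj₁ (proj₂ grown)
        kept = proj₂ (proj₂ grown)

    paths⇒accepting : .{{_ : NonZero k}} → Accepting
    paths⇒accepting with reach-path (pred k) (fromℕ< k-1<k) (toℕ-fromℕ< k-1<k)
      where k-1<k : pred k < k
            k-1<k = ≤-reflexive (suc-pred k)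
    ... | S , r , _ = S , _ , trans (cong suc (toℕ-fromℕ< _)) (suc-pred k) , r

-- The layout of the input

memory-++ˡ : ∀ xs {ys j} → j < length xs → memory (xs ++ ys) j ≡ memory xs j
memory-++ˡ (x ∷ xs) {j = zero}  _       = refl
memory-++ˡ (x ∷ xs) {j = suc j} (s<s j<) = memory-++ˡ xs j<

memory-++ʳ : ∀ xs {ys} j → memory (xs ++ ys) (length xs + j) ≡ memory ys j
memory-++ʳ []       j = refl
memory-++ʳ (x ∷ xs) j = memory-++ʳ xs j

memory-beyond : ∀ xs {j} → length xs ≤ j → memory xs j ≡ 0
memory-beyond []       _        = refl
memory-beyond (x ∷ xs) (s≤s l≤j) = memory-beyond xs l≤j

memory-All : ∀ {b xs} → All (_< suc b) xs → ∀ j → memory xs j < suc b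
memory-All []         j       = z<s
memory-All (x< ∷ xs<) zero    = x<
memory-All (x< ∷ xs<) (suc j) = memory-All xs< j

memory-tabulate : ∀ {m} (f : Fin m → ℕ) v → memory (tabulate f) (toℕ v) ≡ f v
memory-tabulate f zero    = refl
memory-tabulate f (suc v) = memory-tabulate (f ∘ suc) v

module _ {A : Set} {b : ℕ} (f : A → List ℕ) (length-f : ∀ a → length (f a) ≡ b) where

  -- Stated for `tabulate g`, since removing the first block of `allFin` leaves a list tabulated by
  -- `suc` and not another `allFin`.
  length-blocks : ∀ {m} (g : Fin m → A) → length (concatMap f (tabulate g)) ≡ m * b
  length-blocks {zero}  g = refl
  length-blocks {suc m} g =
    trans (length-++ (f (g zero))) (cong₂ _+_ (length-f (g zero)) (length-blocks (g ∘ suc)))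

  memory-blocks : ∀ {m} (g : Fin m → A) i {j} → j < b →
                  memory (concatMap f (tabulate g)) (toℕ i * b + j) ≡ memory (f (g i)) j
  memory-blocks g zero    j<b = memory-++ˡ (f (g zero)) (subst (_ <_) (sym (length-f (g zero))) j<b)
  memory-blocks g (suc i) {j} j<b = begin
    memory (f (g zero) ++ rest) (b + toℕ i * b + j)
      ≡⟨ cong (memory (f (g zero) ++ rest)) (trans (+-assoc b _ j) (cong (_+ (toℕ i * b + j)) (sym (length-f (g zero))))) ⟩
    memory (f (g zero) ++ rest) (length (f (g zero)) + (toℕ i * b + j))
      ≡⟨ memory-++ʳ (f (g zero)) _ ⟩
    memory rest (toℕ i * b + j)
      ≡⟨ memory-blocks (g ∘ suc) i j<b ⟩
    memory (f (g (suc i))) j ∎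
    where
      open ≡-Reasoning
      rest = concatMap f (tabulate (g ∘ suc))

-- One digit of a mixed-radix numbering. It bounds the addresses in the input and orders the rounds
-- of the loop.
block-< : ∀ {q q′ m x} → x < m → q < q′ → q * m + x < q′ * m
block-< {q} {q′} {m} {x} x<m q<q′ = begin-strict
  q * m + x  <⟨ +-monoʳ-< (q * m) x<m ⟩
  q * m + m  ≡⟨ +-comm (q * m) m ⟩
  suc q * m  ≤⟨ *-monoˡ-≤ m q<q′ ⟩
  q′ * m     ∎
  where open ≤-Reasoning

module Layout (I : DisjointPathsInstance) where
  open DisjointPathsInstance I
  open Graph graph using (adj)

  input : List ℕ
  input = encodeInstance I

  pair : Fin k → List ℕ
  pair i = toℕ (s i) ∷ toℕ (t i) ∷ []

  row : Fin n → List ℕ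
  row u = map (λ v → if adj u v then 1 else 0) (allFin n)

  terminals matrix : List ℕ
  terminals = concatMap pair (allFin k)
  matrix    = concatMap row (allFin n)

  matrixBase tableBase cellBase : ℕ
  matrixBase = 2 * k + 2
  tableBase  = matrixBase + n * n
  cellBase   = tableBase + n

  length-terminals : length terminals ≡ k * 2
  length-terminals = length-blocks pair (λ _ → refl) {k} _

  length-row : ∀ u → length (row u) ≡ n
  length-row u = trans (length-map _ (allFin n)) (length-tabulate {n = n} _)

  length-input : length input ≡ tableBase
  length-input = begin
    2 + length (terminals ++ matrix)         ≡⟨ cong (2 +_) (length-++ terminals) ⟩
    2 + (length terminals + length matrix)
      ≡⟨ cong (2 +_) (cong₂ _+_ length-terminals (length-blocks row length-row {n} _)) ⟩
    2 + (k * 2 + n * n)                      ≡⟨ rearrange k n ⟩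
    tableBase                                ∎
    where
      open ≡-Reasoning
      rearrange : ∀ k n → 2 + (k * 2 + n * n) ≡ 2 * k + 2 + n * n
      rearrange = solve-∀

  memory-terminal : ∀ i {j} → j < 2 → memory input (2 * toℕ i + 2 + j) ≡ memory (pair i) j
  memory-terminal i {j} j<2 = begin
    memory input (2 * toℕ i + 2 + j)                ≡⟨ cong (memory input) (rearrange (toℕ i) j) ⟩
    memory (terminals ++ matrix) (toℕ i * 2 + j)
      ≡⟨ memory-++ˡ terminals (subst (toℕ i * 2 + j <_) (sym length-terminals) (block-< j<2 (toℕ<n i))) ⟩
    memory terminals (toℕ i * 2 + j)                ≡⟨ memory-blocks pair (λ _ → refl) _ i j<2 ⟩
    memory (pair i) j ∎
    where
      open ≡-Reasoning
      rearrange : ∀ i j → 2 * i + 2 + j ≡ 2 + (i * 2 + j)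
      rearrange = solve-∀

  memory-s : ∀ i → memory input (2 * toℕ i + 2) ≡ toℕ (s i)
  memory-s i = trans (cong (memory input) (sym (+-identityʳ (2 * toℕ i + 2)))) (memory-terminal i z<s)

  memory-t : ∀ i → memory input (2 * toℕ i + 3) ≡ toℕ (t i)
  memory-t i = trans (cong (memory input) (sym (+-assoc (2 * toℕ i) 2 1))) (memory-terminal i (n<1+n 1))

  memory-adj : ∀ u v → memory input (matrixBase + (toℕ u * n + toℕ v)) ≡ (if adj u v then 1 else 0)
  memory-adj u v = begin
    memory input (matrixBase + a)                      ≡⟨ cong (memory input) (rearrange k a) ⟩
    memory (terminals ++ matrix) (k * 2 + a)
      ≡⟨ cong (λ l → memory (terminals ++ matrix) (l + a)) (sym length-terminals) ⟩
    memory (terminals ++ matrix) (length terminals + a) ≡⟨ memory-++ʳ terminals a ⟩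
    memory matrix a                                    ≡⟨ memory-blocks row length-row _ u (toℕ<n v) ⟩
    memory (map entry (allFin n)) (toℕ v)
      ≡⟨ cong (λ xs → memory xs (toℕ v)) (map-tabulate (λ w → w) entry) ⟩
    memory (tabulate entry) (toℕ v)                    ≡⟨ memory-tabulate entry v ⟩
    (if adj u v then 1 else 0)                         ∎
    where
      open ≡-Reasoning
      a = toℕ u * n + toℕ v
      entry : Fin n → ℕ
      entry w = if adj u w then 1 else 0
      rearrange : ∀ k a → 2 * k + 2 + a ≡ 2 + (k * 2 + a)
      rearrange = solve-∀

  s-address-< : ∀ i → 2 * toℕ i + 2 < tableBase
  s-address-< i = begin-strict
    2 * toℕ i + 2  <⟨ +-monoˡ-< 2 (*-monoʳ-< 2 {toℕ i} {k} (toℕ<n i)) ⟩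
    matrixBase     ≤⟨ m≤m+n matrixBase (n * n) ⟩
    tableBase      ∎
    where open ≤-Reasoning

  t-address-< : ∀ i → 2 * toℕ i + 3 < tableBase
  t-address-< i = begin-strict
    2 * toℕ i + 3              <⟨ n<1+n _ ⟩
    suc (2 * toℕ i + 3)        ≡⟨ rearrange (toℕ i) ⟩
    2 * suc (toℕ i) + 2        ≤⟨ +-monoˡ-≤ 2 (*-monoʳ-≤ 2 {suc (toℕ i)} {k} (toℕ<n i)) ⟩
    matrixBase                 ≤⟨ m≤m+n matrixBase (n * n) ⟩
    tableBase                  ∎
    where
      open ≤-Reasoning
      rearrange : ∀ i → suc (2 * i + 3) ≡ 2 * suc i + 2
      rearrange = solve-∀

  adj-address-< : ∀ u v → matrixBase + (toℕ u * n + toℕ v) < tableBase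
  adj-address-< u v = +-monoʳ-< matrixBase (block-< {toℕ u} {n} (toℕ<n v) (toℕ<n u))

  k≤n : k ≤ n
  k≤n = injective⇒≤ s-injective

  memory-input-< : 1 ≤ n → ∀ a → memory input a < suc n
  memory-input-< 1≤n = memory-All (n<1+n n ∷ s≤s k≤n ∷ All.++⁺ small-terminals small-matrix)
    where
      small-terminals : All (_< suc n) terminals
      small-terminals = All.concat⁺ (All.map⁺ (All.tabulate⁺ (λ i →
        m<n⇒m<1+n (toℕ<n (s i)) ∷ m<n⇒m<1+n (toℕ<n (t i)) ∷ [])))
      small : ∀ (c : Bool) → (if c then 1 else 0) < suc n
      small true  = s≤s 1≤n
      small false = z<s
      small-matrix : All (_< suc n) matrix
      small-matrix = All.concat⁺ (All.map⁺ (All.tabulate⁺ (λ u → All.map⁺ (All.tabulate⁺ (λ v → small (adj u v))))))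

-- Reasoning about runs

-- Time-bounded total correctness, in continuation style: the postcondition Q
-- of a sequence's first part is the claim about its second part.
Runs : ℕ → Program → State → ℕ → (State → Set) → Set
Runs w p σ t Q = ∃[ t′ ] ∃[ τ ] w ⊢ p , σ ⇓[ t′ ] τ × t′ ≤ t × Q τ

Holds : Test → State → Set
Holds (test eq x y) σ = reg σ x ≡ reg σ y
Holds (test lt x y) σ = reg σ x < reg σ y

holds? : ∀ b σ → Dec (Holds b σ)
holds? (test eq x y) σ = reg σ x ≟ reg σ y
holds? (test lt x y) σ = reg σ x <? reg σ y

-- The decision procedures for numbers compute by the same boolean functions as the machine, so
-- tests can be handled as propositions about registers.
does-holds? : ∀ b σ → does (holds? b σ) ≡ ⟦ b ⟧ᵗ σ
does-holds? (test eq x y) σ = refl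
does-holds? (test lt x y) σ = refl

holds⇒true : ∀ b {σ} → Holds b σ → ⟦ b ⟧ᵗ σ ≡ true
holds⇒true b {σ} h = trans (sym (does-holds? b σ)) (dec-true (holds? b σ) h)

¬holds⇒false : ∀ b {σ} → ¬ Holds b σ → ⟦ b ⟧ᵗ σ ≡ false
¬holds⇒false b {σ} ¬h = trans (sym (does-holds? b σ)) (dec-false (holds? b σ) ¬h)

AllHold : List Test → State → Set
AllHold []       σ = ⊤
AllHold (b ∷ bs) σ = Holds b σ × AllHold bs σ

guarded : List Test → Program → Program
guarded []       p = p
guarded (b ∷ bs) p = ifElse b (guarded bs p) skip

module _ {w : ℕ} where

  private variable
    σ   : State
    Q R : State → Set
    p q : Program
    b   : Test
    t u : ℕ

  weaken : t ≤ u → Runs w p σ t Q → Runs w p σ u Q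
  weaken t≤u (_ , _ , run , t′≤t , post) = _ , _ , run , ≤-trans t′≤t t≤u , post

  runs-const : ∀ {x a} → a < 2 ^ w → Q (setReg x a σ) → Runs w (const x a) σ 1 Q
  runs-const a< post = _ , _ , const a< , ≤-refl , post

  -- The result `c` is chosen by the caller and only equated with what the machine computes. The
  -- state then carries a meaningful expression in place of an unevaluated quotient or remainder,
  -- and later reads of it close by `refl`.
  runs-arith : ∀ {x o y z a b} c → reg σ y ≡ a → reg σ z ≡ b → ⟦ o ⟧ᵒ a b ≡ c → c < 2 ^ w →
               Q (setReg x c σ) → Runs w (arith x o y z) σ 1 Q
  runs-arith _ refl refl refl c< post = _ , _ , arith c< , ≤-refl , post

  runs-load : ∀ {x y a} c → reg σ y ≡ a → mem σ a ≡ c → c < 2 ^ w →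
              Q (setReg x c σ) → Runs w (load x y) σ 1 Q
  runs-load _ refl refl c< post = _ , _ , load c< , ≤-refl , post

  runs-store : ∀ {x y a c} → reg σ x ≡ a → reg σ y ≡ c → Q (setMem a c σ) → Runs w (store x y) σ 1 Q
  runs-store refl refl post = _ , _ , store , ≤-refl , post

  runs-seq : Runs w p σ t (λ τ → Runs w q τ u Q) → Runs w (p ⨾ q) σ (t + u) Q
  runs-seq (_ , _ , run , t′≤t , _ , _ , run′ , u′≤u , post) =
    _ , _ , seq run run′ , +-mono-≤ t′≤t u′≤u , post


  arith⨾ : ∀ {x o y z a b} c → reg σ y ≡ a → reg σ z ≡ b → ⟦ o ⟧ᵒ a b ≡ c → c < 2 ^ w →
           Runs w q (setReg x c σ) u Q → Runs w (arith x o y z ⨾ q) σ (suc u) Q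
  arith⨾ c y≡ z≡ c≡ c< rest = runs-seq (runs-arith c y≡ z≡ c≡ c< rest)

  load⨾ : ∀ {x y a} c → reg σ y ≡ a → mem σ a ≡ c → c < 2 ^ w →
          Runs w q (setReg x c σ) u Q → Runs w (load x y ⨾ q) σ (suc u) Q
  load⨾ c y≡ c≡ c< rest = runs-seq (runs-load c y≡ c≡ c< rest)

  const⨾ : ∀ {x a} → a < 2 ^ w → Runs w q (setReg x a σ) u Q → Runs w (const x a ⨾ q) σ (suc u) Q
  const⨾ a< rest = runs-seq (runs-const a< rest)

  store⨾ : ∀ {x y} a c → reg σ x ≡ a → reg σ y ≡ c →
           Runs w q (setMem a c σ) u Q → Runs w (store x y ⨾ q) σ (suc u) Q
  store⨾ _ _ x≡ y≡ rest = runs-seq (runs-store x≡ y≡ rest)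

  runs-if : ∀ {t} → (Holds b σ → Runs w p σ t Q) → (¬ Holds b σ → Runs w q σ t Q) →
            Runs w (ifElse b p q) σ (1 + t) Q
  runs-if {b = b} {σ = σ} yes-case no-case with holds? b σ
  ... | yes h with yes-case h
  ...   | _ , _ , run , t′≤t , post = _ , _ , if-true (holds⇒true b h) run , s≤s t′≤t , post
  runs-if {b = b} {σ = σ} yes-case no-case | no ¬h with no-case ¬h
  ...   | _ , _ , run , t′≤t , post = _ , _ , if-false (¬holds⇒false b ¬h) run , s≤s t′≤t , post

  -- A failed test leaves the state unchanged but still pays for `skip`; granting the body at least
  -- one step lets both outcomes share a bound.
  runs-guarded : ∀ bs → (AllHold bs σ → Runs w p σ (suc t) Q) → (¬ AllHold bs σ → Q σ) →
                 Runs w (guarded bs p) σ (length bs + suc t) Q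
  runs-guarded []       pass fail = pass tt
  runs-guarded (b ∷ bs) pass fail = runs-if {b = b}
    (λ h → runs-guarded bs (λ hs → pass (h , hs)) (λ ¬hs → fail (λ hhs → ¬hs (proj₂ hhs))))
    (λ ¬h → _ , _ , skip , ≤-trans (s≤s z≤n) (m≤n+m _ (length bs)) , fail (λ hhs → ¬h (proj₁ hhs)))

  runs-map : (∀ {τ} → Q τ → R τ) → Runs w p σ t Q → Runs w p σ t R
  runs-map f (_ , _ , run , t′≤t , post) = _ , _ , run , t′≤t , f post

  runs-while : Holds b σ → Runs w p σ t (λ τ → Runs w (while b p) τ u Q) →
               Runs w (while b p) σ (suc (t + u)) Q
  runs-while {b = b} h (_ , _ , run , t′≤t , _ , _ , run′ , u′≤u , post) =
    _ , _ , while-true (holds⇒true b h) run run′ , s≤s (+-mono-≤ t′≤t u′≤u) , post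

  -- A round costs its body and one test, and the extra step is the final failing test. The
  -- induction runs over the rounds left.
  runs-for : (Inv : ℕ → State → Set) (m : ℕ) →
             (∀ {j σ} → Inv j σ → j < m → Holds b σ) →
             (∀ {σ} → Inv m σ → ¬ Holds b σ) →
             (∀ {j σ} → Inv j σ → j < m → Runs w p σ t (Inv (suc j))) →
             Inv 0 σ → Runs w (while b p) σ (suc (m * suc t)) (Inv m)
  runs-for {b = b} {p = p} {t = t} Inv m enter leave step inv₀ = go m 0 (+-identityʳ m) inv₀
    where
      go : ∀ left j {σ} → left + j ≡ m → Inv j σ → Runs w (while b p) σ (suc (left * suc t)) (Inv m)
      go zero       j refl inv = _ , _ , while-false (¬holds⇒false b (leave inv)) , ≤-refl , inv
      go (suc left) j j≡ inv = weaken (s≤s (≤-reflexive (+-suc t (left * suc t))))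
        (runs-while (enter inv j<m) (runs-map (go left (suc j) (trans (+-suc left j) j≡)) (step inv j<m)))
        where j<m = subst (suc j ≤_) j≡ (s≤s (m≤n+m j left))

-- The program and its invariants

div-≡ : ∀ a b .{{_ : NonZero b}} → ⟦ div ⟧ᵒ a b ≡ a / b
div-≡ a (suc b) = refl

mod-≡ : ∀ a b .{{_ : NonZero b}} → ⟦ mod ⟧ᵒ a b ≡ a % b
mod-≡ a (suc b) = refl

block-% : ∀ q {m x} .{{_ : NonZero m}} → x < m → (q * m + x) % m ≡ x
block-% q {m} {x} x<m = trans (cong (_% m) (+-comm (q * m) x)) (trans ([m+kn]%n≡m%n x q m) (m<n⇒m%n≡m x<m))

block-/ : ∀ q {m x} .{{_ : NonZero m}} → x < m → (q * m + x) / m ≡ q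
block-/ q {m} {x} x<m = begin
  (q * m + x) / m    ≡⟨ +-distrib-/ (q * m) x (subst (λ r → r + x % m < m) (sym (m*n%n≡0 q m)) (m%n<n x m)) ⟩
  q * m / m + x / m  ≡⟨ cong₂ _+_ (m*n/n≡m q m) (m<n⇒m/n≡0 x<m) ⟩
  q + 0              ≡⟨ +-identityʳ q ⟩
  q                  ∎
  where open ≡-Reasoning

block-injective : ∀ q q′ {m x x′} .{{_ : NonZero m}} → x < m → x′ < m →
                  q * m + x ≡ q′ * m + x′ → q ≡ q′ × x ≡ x′
block-injective q q′ {m} x<m x′<m eq′ =
  trans (sym (block-/ q x<m)) (trans (cong (_/ m) eq′) (block-/ q′ x′<m)) ,
  trans (sym (block-% q x<m)) (trans (cong (_% m) eq′) (block-% q′ x′<m))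

update-same : ∀ f {x a} → (f [ x ↦ a ]) x ≡ a
update-same f {x} {a} with x ≡ᵇ x | ≡⇒≡ᵇ x x refl
... | true | _ = refl

update-other : ∀ f {x a y} → y ≢ x → (f [ x ↦ a ]) y ≡ f y
update-other f {x} {a} {y} y≢x with y ≡ᵇ x in y≡ᵇx
... | true  = contradiction (≡ᵇ⇒≡ y x (subst T (sym y≡ᵇx) _)) y≢x
... | false = refl

n<2^n : ∀ n → n < 2 ^ n
n<2^n zero    = z<s
n<2^n (suc n) = begin-strict
  suc n            ≤⟨ n<2^n n ⟩
  2 ^ n            <⟨ m<m+n (2 ^ n) (>-nonZero⁻¹ _ {{m^n≢0 2 n}}) ⟩
  2 ^ n + 2 ^ n    ≡⟨ cong (2 ^ n +_) (sym (+-identityʳ (2 ^ n))) ⟩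
  2 ^ suc n        ∎
  where open ≤-Reasoning

-- Magnitudes and the word length

-- The exponent that the `Small` calculus assigns to the largest value, the target address of a jump
-- in register 24.
wordFactor : ℕ
wordFactor = 8

module Bounds (n : ℕ) where

  -- One digit in this base holds a vertex, an index or a mask, the value `2 ^ n` included. As
  -- `base` is at least 2, each sum costs one further digit, and `base ^ wordFactor` equals `2 ^ w`.
  base w : ℕ
  base = 2 ^ suc n
  w    = wordFactor * suc n

  -- Bounds are tracked by the exponent alone, so that fitting in a word is
  -- decided by comparing closed numbers.
  record Small (e x : ℕ) : Set where
    constructor small
    field below : x < base ^ e

  2≤base : 2 ≤ base
  2≤base = *-monoʳ-≤ 2 (>-nonZero⁻¹ (2 ^ n) {{m^n≢0 2 n}})

  private instance
    base≢0 : NonZero base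
    base≢0 = m^n≢0 2 (suc n)

  small-mono : ∀ {d e x} → d ≤ e → Small d x → Small e x
  small-mono d≤e (small x<) = small (<-≤-trans x< (^-monoʳ-≤ base d≤e))

  small-≤ : ∀ {e x y} → x ≤ y → Small e y → Small e x
  small-≤ x≤y (small y<) = small (≤-<-trans x≤y y<)

  small-base : ∀ {x} → x < base → Small 1 x
  small-base x< = small (<-≤-trans x< (≤-reflexive (sym (*-identityʳ base))))

  infixl 7 _*ˢ_
  infixl 6 _+ˢ_

  _*ˢ_ : ∀ {d e x y} → Small d x → Small e y → Small (d + e) (x * y)
  _*ˢ_ {d} {e} (small x<) (small y<) = small (<-≤-trans (*-mono-< x< y<) (≤-reflexive (sym (^-distribˡ-+-* base d e))))

  _+ˢ_ : ∀ {d e x y} → Small d x → Small e y → Small (suc (d ⊔ e)) (x + y)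
  _+ˢ_ {d} {e} {x} {y} x-small y-small = small (begin-strict
    x + y
      <⟨ +-mono-< (below (small-mono (m≤m⊔n d e) x-small)) (below (small-mono (m≤n⊔m d e) y-small)) ⟩
    base ^ (d ⊔ e) + base ^ (d ⊔ e)  ≡⟨ cong (base ^ (d ⊔ e) +_) (sym (+-identityʳ _)) ⟩
    2 * base ^ (d ⊔ e)               ≤⟨ *-monoˡ-≤ (base ^ (d ⊔ e)) 2≤base ⟩
    base ^ suc (d ⊔ e)               ∎)
    where
      open ≤-Reasoning
      open Small

  small-word : ∀ {e x} → Small e x → {T (e ≤ᵇ wordFactor)} → x < 2 ^ w
  small-word {e} x-small {e≤} = <-≤-trans (Small.below (small-mono (≤ᵇ⇒≤ e wordFactor e≤) x-small)) (≤-reflexive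
    (trans (^-*-assoc 2 (suc n) wordFactor) (cong (2 ^_) (*-comm (suc n) wordFactor))))

  small-1 : Small 1 1
  small-1 = small-base 2≤base

  small-n : Small 1 n
  small-n = small-base (<-trans (n<1+n n) (n<2^n (suc n)))

-- Registers: 0 answer, 1 n, 2 k, 3 the constant 1, 4 the constant 2,
-- 5 adjacency matrix, 6 table of powers of 2, 7 table of cells (addresses),
-- 8 loop counter, 9 loop bound, 10 the constant 0, from 11 on temporaries.

markExtend markJump acceptLast marks inner body fillTable prepare markFirst program : Program

markExtend = guarded (test eq 21 10 ∷ test eq 22 3 ∷ []) (store 23 3)
markJump   = guarded (test eq 21 10 ∷ test eq 14 18 ∷ test eq 11 17 ∷ test lt 19 2 ∷ []) (store 24 3)
acceptLast = guarded (test eq 14 18 ∷ test eq 19 2 ∷ []) (const 0 1)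
marks      = markExtend ⨾ markJump ⨾ acceptLast

-- 11 v, 12 cell, 14 u, 15 i, 16 S, 17 t of the next pair, 18 sᵢ, 19 i + 1,
-- 20 2ᵛ, 21 bit v of S, 22 adjacency of v and u, 23 and 24 target addresses.
inner =
  arith 14 mod 12 1 ⨾
  arith 12 div 12 1 ⨾
  arith 15 mod 12 2 ⨾
  arith 16 div 12 2 ⨾
  arith 17 mul 4 15 ⨾
  arith 18 add 17 4 ⨾
  load 18 18 ⨾
  -- The pair after `i` has its target at address 2 (i + 1) + 3 = 2 i + 5. Register 19 is only
  -- borrowed for the constant.
  const 19 5 ⨾
  arith 17 add 17 19 ⨾
  load 17 17 ⨾
  arith 19 add 15 3 ⨾
  arith 20 add 6 11 ⨾
  load 20 20 ⨾
  arith 21 div 16 20 ⨾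
  arith 21 mod 21 4 ⨾
  arith 22 mul 11 1 ⨾
  arith 22 add 22 14 ⨾
  arith 22 add 5 22 ⨾
  load 22 22 ⨾
  arith 23 add 16 20 ⨾
  arith 23 mul 23 2 ⨾
  arith 23 add 23 15 ⨾
  arith 23 mul 23 1 ⨾
  arith 23 add 23 11 ⨾
  arith 23 add 7 23 ⨾
  -- Passing to the next pair with the same mask and vertex raises the cell number by `n`.
  arith 24 add 23 1 ⨾
  marks

body =
  arith 11 mod 8 1 ⨾
  arith 12 div 8 1 ⨾
  arith 13 add 7 12 ⨾
  load 13 13 ⨾
  guarded (test eq 13 3 ∷ []) inner ⨾
  arith 8 add 8 3

fillTable =
  arith 11 add 6 8 ⨾
  store 11 9 ⨾
  arith 9 mul 9 4 ⨾
  arith 8 add 8 3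

markFirst =
  -- The loop filling the table leaves `2 ^ n` in register 9, which now becomes the number of
  -- rounds.
  arith 9 mul 9 2 ⨾
  arith 9 mul 9 1 ⨾
  arith 9 mul 9 1 ⨾
  const 12 3 ⨾
  load 11 12 ⨾
  arith 12 add 6 11 ⨾
  load 12 12 ⨾
  arith 12 mul 12 2 ⨾
  arith 12 mul 12 1 ⨾
  arith 12 add 12 11 ⨾
  arith 12 add 7 12 ⨾
  store 12 3 ⨾
  const 8 0 ⨾
  while (test lt 8 9) body

prepare =
  const 4 2 ⨾
  arith 5 mul 4 2 ⨾
  arith 5 add 5 4 ⨾
  arith 6 mul 1 1 ⨾
  arith 6 add 5 6 ⨾
  arith 7 add 6 1 ⨾
  const 9 1 ⨾
  while (test lt 8 1) fillTable ⨾
  markFirst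

-- Register 0 is initially 0 and serves as that constant here.
program =
  load 1 0 ⨾
  const 3 1 ⨾
  load 2 3 ⨾
  ifElse (test eq 2 0) (const 0 1) prepare

-- Correctness of the loop over all rounds

module Verification (I : DisjointPathsInstance) {{k≢0 : NonZero (DisjointPathsInstance.k I)}} where
  open DisjointPathsInstance I
  open Graph graph using (Adj; adj)
  open Search I
  open Layout I
  open Bounds n

  instance
    n≢0 : NonZero n
    n≢0 = >-nonZero (≤-trans (>-nonZero⁻¹ k) k≤n)

  cell : ℕ → Fin k → Fin n → ℕ
  cell S i u = (S * k + toℕ i) * n + toℕ u

  -- The mask is the leading digit, so the round trying a transition precedes every round that reads
  -- its target.
  cell-mono : ∀ {S S′} i u v i′ u′ → S < S′ → cell S i u * n + toℕ v < cell S′ i′ u′ * n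
  cell-mono {S} {S′} i u v i′ u′ S<S′ = block-< (toℕ<n v)
    (<-≤-trans (block-< (toℕ<n u) (<-≤-trans (block-< {S} (toℕ<n i) S<S′) (m≤m+n (S′ * k) (toℕ i′))))
               (m≤m+n ((S′ * k + toℕ i′) * n) (toℕ u′)))

  cell-injective : ∀ {S S′ i i′ u u′} → cell S i u ≡ cell S′ i′ u′ → S ≡ S′ × i ≡ i′ × u ≡ u′
  cell-injective {S} {S′} {i} {i′} {u} {u′} eq′
    with block-injective (S * k + toℕ i) (S′ * k + toℕ i′) (toℕ<n u) (toℕ<n u′) eq′
  ... | eq″ , u≡ with block-injective S S′ (toℕ<n i) (toℕ<n i′) eq″
  ...   | S≡ , i≡ = S≡ , toℕ-injective i≡ , toℕ-injective u≡

  total : ℕ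
  total = 2 ^ n * k * n * n

  cell-total : ∀ {S i u} v → Reach S i u → cell S i u * n + toℕ v < total
  cell-total {S} {i} {u} v r = block-< (toℕ<n v) (block-< (toℕ<n u) (block-< {S} (toℕ<n i) (Reach-< r)))

  Marked : (ℕ → ℕ) → ℕ → Set
  Marked m Y = m (cellBase + Y) ≡ 1

  -- `narrow` covers all addresses, because cells and the word read past the last terminal must fit
  -- into a register as well.
  record Tables (m : ℕ → ℕ) : Set where
    field
      inputs : ∀ {a} → a < tableBase → m a ≡ memory input a
      powers : ∀ {j} → j < n → m (tableBase + j) ≡ 2 ^ j
      narrow : ∀ a → m a < base

  record Correct (m : ℕ → ℕ) (r : ℕ) : Set where
    field
      tables : Tables m
      sound  : ∀ Y → Marked m Y → ∃[ S ] ∃[ i ] ∃[ u ] Reach S i u × Y ≡ cell S i u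
      answer : (r ≡ 1 × Accepting) ⊎ r ≡ 0
    open Tables tables public

  record Closed (m : ℕ → ℕ) (r S : ℕ) (i : Fin k) (u v : Fin n) : Set where
    field
      by-extend : bit (toℕ v) S ≡ 0 → Adj v u → Marked m (cell (S + 2 ^ toℕ v) i v)
      by-jump   : ∀ {j} → bit (toℕ v) S ≡ 0 → u ≡ s i → v ≡ t j → toℕ j ≡ suc (toℕ i) →
                  Marked m (cell (S + 2 ^ toℕ v) j v)
      by-accept : u ≡ s i → suc (toℕ i) ≡ k → r ≡ 1

  -- Phrased by the transitions of the rounds below `X`: that all reachable triples are marked need
  -- not hold in mid-loop. `reached-marked` recovers it for the triples that are due.
  record Complete (X : ℕ) (m : ℕ → ℕ) (r : ℕ) : Set where
    field
      first  : ∀ {i} → toℕ i ≡ 0 → Marked m (cell (2 ^ toℕ (t i)) i (t i))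
      closed : ∀ {S i u} → Reach S i u → ∀ v → cell S i u * n + toℕ v < X → Closed m r S i u v

  Marked-⊆ : (m m′ : ℕ → ℕ) → Set
  Marked-⊆ m m′ = ∀ {Y} → Marked m Y → Marked m′ Y

  complete-mono : ∀ {X m m′ r r′} → Marked-⊆ m m′ → (r ≡ 1 → r′ ≡ 1) → Complete X m r → Complete X m′ r′
  complete-mono m⊆ r⊆ c = record
    { first  = λ i≡0 → m⊆ (Complete.first c i≡0)
    ; closed = λ r v lt′ → let open Closed (Complete.closed c r v lt′) in record
        { by-extend = λ free v~u → m⊆ (by-extend free v~u)
        ; by-jump   = λ free u≡ v≡ j≡ → m⊆ (by-jump free u≡ v≡ j≡)
        ; by-accept = λ u≡ i≡ → r⊆ (by-accept u≡ i≡)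
        }
    }

  complete-suc : ∀ {X m r} → Complete X m r →
                 (∀ {S i u} → Reach S i u → ∀ v → cell S i u * n + toℕ v ≡ X → Closed m r S i u v) →
                 Complete (suc X) m r
  complete-suc {X} c new = record
    { first  = Complete.first c
    ; closed = λ {S} {i} {u} r v lt′ → case-≤ r v (m≤n⇒m<n∨m≡n (≤-pred lt′))
    }
    where
      case-≤ : ∀ {S i u} → Reach S i u → ∀ v →
               cell S i u * n + toℕ v < X ⊎ cell S i u * n + toℕ v ≡ X → Closed _ _ S i u v
      case-≤ r v (inj₁ lt′) = Complete.closed c r v lt′
      case-≤ r v (inj₂ eq′) = new r v eq′

  -- Bits are only ever added, so a cell is marked before it is read.
  reached-marked : ∀ {X m r S i u} → Complete X m r → Reach S i u → cell S i u * n ≤ X → Marked m (cell S i u)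
  reached-marked c (start i≡0) _ = Complete.first c i≡0
  reached-marked c (extend {S} {i} {u} {v} r free v~u) ≤X =
    Closed.by-extend (Complete.closed c r v (<-≤-trans (cell-mono i u v i v (m<m+n S 0<2^)) ≤X)) free v~u
    where 0<2^ = >-nonZero⁻¹ _ {{m^n≢0 2 (toℕ v)}}
  reached-marked c (jump {S} {i} {j} r j≡ free) ≤X =
    Closed.by-jump (Complete.closed c r (t j) (<-≤-trans (cell-mono i (s i) (t j) j (t j) (m<m+n S 0<2^)) ≤X))
      free refl refl j≡
    where 0<2^ = >-nonZero⁻¹ _ {{m^n≢0 2 (toℕ (t j))}}

  module _ {m : ℕ → ℕ} {Y : ℕ} where

    private m′ = m [ cellBase + Y ↦ 1 ]

    mark-here : Marked m′ Y
    mark-here = update-same m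

    mark-⊆ : Marked-⊆ m m′
    mark-⊆ {Y′} marked with Y′ ≟ Y
    ... | yes refl = mark-here
    ... | no Y′≢Y  = trans (update-other m (λ e → Y′≢Y (+-cancelˡ-≡ cellBase _ _ e))) marked

    mark-tables : Tables m → Tables m′
    mark-tables tb = record
      { inputs = λ {a} a< → trans (below (<-≤-trans a< (m≤m+n tableBase n))) (inputs a<)
      ; powers = λ {j} j< → trans (below (+-monoʳ-< tableBase j<)) (powers j<)
      ; narrow = narrow′
      }
      where
        open Tables tb
        below : ∀ {a} → a < cellBase → m′ a ≡ m a
        below a< = update-other m (<⇒≢ (<-≤-trans a< (m≤m+n cellBase Y)))
        narrow′ : ∀ a → m′ a < base
        narrow′ a with a ≟ cellBase + Y
        ... | yes refl = subst (_< base) (sym (update-same m)) 2≤base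
        ... | no a≢    = subst (_< base) (sym (update-other m a≢)) (narrow a)

    mark-correct : ∀ {r S i u} → Reach S i u → Y ≡ cell S i u → Correct m r → Correct m′ r
    mark-correct {r} {S} {i} {u} reach Y≡ c = record
      { tables = mark-tables (Correct.tables c)
      ; sound  = sound′
      ; answer = Correct.answer c
      }
      where
        sound′ : ∀ Y′ → Marked m′ Y′ → ∃[ S ] ∃[ i ] ∃[ u ] Reach S i u × Y′ ≡ cell S i u
        sound′ Y′ marked with Y′ ≟ Y
        ... | yes refl = S , i , u , reach , Y≡
        ... | no Y′≢Y  = Correct.sound c Y′
                (trans (sym (update-other m (λ e → Y′≢Y (+-cancelˡ-≡ cellBase _ _ e)))) marked)

  Constants : State → Set
  Constants σ = reg σ 1 ≡ n × reg σ 2 ≡ k × reg σ 3 ≡ 1 × reg σ 4 ≡ 2 × reg σ 5 ≡ matrixBase ×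
                reg σ 6 ≡ tableBase × reg σ 7 ≡ cellBase × reg σ 9 ≡ total × reg σ 10 ≡ 0

  Invariant : ℕ → State → Set
  Invariant X σ = Constants σ × reg σ 8 ≡ X × Correct (mem σ) (reg σ 0) × Complete X (mem σ) (reg σ 0)

  -- The state between the marks of a round and the increment: round `X` is done while the counter
  -- still shows `X`.
  Processed : ℕ → State → Set
  Processed X σ = Constants σ × reg σ 8 ≡ X × Correct (mem σ) (reg σ 0) × Complete (suc X) (mem σ) (reg σ 0)

  small-const : ∀ {c} e → c < 2 ^ e → Small e c
  small-const e c< = small (<-≤-trans c< (^-monoˡ-≤ e 2≤base))

  small-2 : Small 2 2
  small-2 = small-const 2 (s≤s (s≤s (s≤s z≤n)))

  small-k : Small 1 k
  small-k = small-≤ k≤n small-n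

  small-vertex : (v : Fin n) → Small 1 (toℕ v)
  small-vertex v = small-≤ (<⇒≤ (toℕ<n v)) small-n

  small-index : (i : Fin k) → Small 1 (toℕ i)
  small-index i = small-≤ (<⇒≤ (toℕ<n i)) small-k

  small-mask : ∀ {S} → S ≤ 2 ^ n → Small 1 S
  small-mask S≤ = small-base (≤-<-trans S≤ (^-monoʳ-< 2 (n<1+n 1) (n<1+n n)))

  small-matrixBase : Small 4 matrixBase
  small-matrixBase = small-2 *ˢ small-k +ˢ small-2

  small-tableBase : Small 5 tableBase
  small-tableBase = small-matrixBase +ˢ small-n *ˢ small-n

  small-cellBase : Small 6 cellBase
  small-cellBase = small-tableBase +ˢ small-n

  small-total : Small 4 total
  small-total = small-mask ≤-refl *ˢ small-k *ˢ small-n *ˢ small-n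

  cell-next : ∀ S {i j} v → toℕ j ≡ suc (toℕ i) → cell S i v + n ≡ cell S j v
  cell-next S {i} {j} v j≡ = trans (rearrange (S * k) (toℕ i) n (toℕ v))
                                   (cong (λ l → (S * k + l) * n + toℕ v) (sym j≡))
    where
      rearrange : ∀ a i n v → (a + i) * n + v + n ≡ (a + suc i) * n + v
      rearrange = solve-∀

  module _ {S : ℕ} {i : Fin k} {u v : Fin n} (reach : Reach S i u)
           {X : ℕ} (X≡ : cell S i u * n + toℕ v ≡ X) where

    -- The digits of `X` determine the triple and the vertex, so a single `Closed` is all that round
    -- `X` has to contribute.
    close : ∀ {m r} → Closed m r S i u v → Complete X m r → Complete (suc X) m r
    close {m} {r} cl c = complete-suc c at-X
      where
        at-X : ∀ {S′ i′ u′} → Reach S′ i′ u′ → ∀ v′ → cell S′ i′ u′ * n + toℕ v′ ≡ X → Closed m r S′ i′ u′ v′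
        at-X {S′} {i′} {u′} _ v′ X≡′
          with block-injective (cell S′ i′ u′) (cell S i u) (toℕ<n v′) (toℕ<n v) (trans X≡′ (sym X≡))
        ... | cell≡ , v≡ with cell-injective {S′} {S} cell≡ | toℕ-injective v≡
        ...   | refl , refl , refl | refl = cl

    -- Register 17 is specified only if a next pair exists; after the last pair it holds an
    -- unrelated word, and the test of i + 1 against `k` prevents a mark. The bound is 3 + 5 + 3,
    -- each guarded command taking its tests and one more step.
    runs-marks : ∀ {ρ} → Constants ρ → reg ρ 8 ≡ X → reg ρ 11 ≡ toℕ v → reg ρ 14 ≡ toℕ u →
      (∀ {j} → toℕ j ≡ suc (toℕ i) → reg ρ 17 ≡ toℕ (t j)) → reg ρ 18 ≡ toℕ (s i) →
      reg ρ 19 ≡ suc (toℕ i) → reg ρ 21 ≡ bit (toℕ v) S → reg ρ 22 ≡ (if adj v u then 1 else 0) →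
      reg ρ 23 ≡ cellBase + cell (S + 2 ^ toℕ v) i v → reg ρ 24 ≡ cellBase + cell (S + 2 ^ toℕ v) i v + n →
      Correct (mem ρ) (reg ρ 0) → Complete X (mem ρ) (reg ρ 0) → Runs w marks ρ 11 (Processed X)
    runs-marks {⟨ f , m₀ ⟩} consts@(_ , f2 , f3 , _ , _ , _ , _ , _ , f10) f8 f11 f14 f17 f18 f19 f21 f22 f23 f24
      correct₀ complete₀ = runs-seq $ runs-guarded (test eq 21 10 ∷ test eq 22 3 ∷ [])
        (λ (f21≡0 , f22≡1 , _) → runs-store f23 f3
          (jumps (mark-correct
                   (extend reach (trans (sym f21) (trans f21≡0 f10)) (adjacent (trans f22≡1 f3))) refl correct₀)
                 (complete-mono (mark-⊆ {m₀}) id complete₀) (λ _ _ → mark-here {m₀})))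
        (λ ¬holds → jumps correct₀ complete₀
          (λ free v~u → contradiction
            (trans f21 (trans free (sym f10)) , trans f22 (trans (adjacent⁻¹ v~u) (sym f3)) , tt) ¬holds))
      where
        p = 2 ^ toℕ v

        adjacent : f 22 ≡ 1 → Adj v u
        adjacent f22≡1 with adj v u | trans (sym f22) f22≡1
        ... | true | _ = tt

        adjacent⁻¹ : Adj v u → (if adj v u then 1 else 0) ≡ 1
        adjacent⁻¹ v~u with adj v u
        ... | true = refl

        Extended Jumped : (ℕ → ℕ) → Set
        Extended m = bit (toℕ v) S ≡ 0 → Adj v u → Marked m (cell (S + p) i v)
        Jumped   m = ∀ {j} → bit (toℕ v) S ≡ 0 → u ≡ s i → v ≡ t j → toℕ j ≡ suc (toℕ i) →
                     Marked m (cell (S + p) j v)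

        accepts : ∀ {m} → Correct m (f 0) → Complete X m (f 0) → Extended m → Jumped m →
                  Runs w acceptLast ⟨ f , m ⟩ 3 (Processed X)
        accepts correct complete ext jmp = runs-guarded (test eq 14 18 ∷ test eq 19 2 ∷ [])
          (λ (f14≡f18 , f19≡f2 , _) → runs-const (small-word small-1)
            (consts , f8
            , record { tables = Correct.tables correct ; sound = Correct.sound correct
                     ; answer = inj₁ (refl , S , i , trans (sym f19) (trans f19≡f2 f2)
                                     , subst (Reach S i) (toℕ-injective (trans (sym f14) (trans f14≡f18 f18))) reach) }
            , close (record { by-extend = ext ; by-jump = jmp ; by-accept = λ _ _ → refl })
                    (complete-mono id (λ _ → refl) complete)))
          (λ ¬holds → consts , f8 , correct
            , close (record { by-extend = ext ; by-jump = jmp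
                            ; by-accept = λ u≡ i≡ → contradiction
                                ( trans f14 (trans (cong toℕ u≡) (sym f18))
                                , trans f19 (trans i≡ (sym f2)) , tt) ¬holds })
                    complete)

        jumps : ∀ {m} → Correct m (f 0) → Complete X m (f 0) → Extended m →
                Runs w (markJump ⨾ acceptLast) ⟨ f , m ⟩ 8 (Processed X)
        jumps {m} correct complete ext = runs-seq $
          runs-guarded (test eq 21 10 ∷ test eq 14 18 ∷ test eq 11 17 ∷ test lt 19 2 ∷ []) pass fail
          where
            Rest : State → Set
            Rest τ = Runs w acceptLast τ 3 (Processed X)
            pass : AllHold (test eq 21 10 ∷ test eq 14 18 ∷ test eq 11 17 ∷ test lt 19 2 ∷ []) ⟨ f , m ⟩ →
                   Runs w (store 24 3) ⟨ f , m ⟩ 1 Rest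
            pass (f21≡ , f14≡ , f11≡ , f19< , _) = runs-store address f3
              (accepts (mark-correct (subst (Reach (S + p) j) (sym v≡) reach′) refl correct)
                       (complete-mono (mark-⊆ {m}) id complete)
                       (λ free v~u → mark-⊆ {m} (ext free v~u))
                       (λ {j′} _ _ _ j′≡ → subst (λ l → Marked m′ (cell (S + p) l v))
                                                 (toℕ-injective (trans j≡ (sym j′≡))) (mark-here {m})))
              where
                1+i<k : suc (toℕ i) < k
                1+i<k = subst₂ _<_ f19 f2 f19<
                j : Fin k
                j = fromℕ< 1+i<k
                j≡ : toℕ j ≡ suc (toℕ i)
                j≡ = toℕ-fromℕ< 1+i<k
                m′ = m [ cellBase + cell (S + p) j v ↦ 1 ]
                v≡ : v ≡ t j
                v≡ = toℕ-injective (trans (sym f11) (trans f11≡ (f17 j≡)))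
                reach′ : Reach (S + p) j (t j)
                reach′ = subst (λ x → Reach (S + 2 ^ toℕ x) j (t j)) (sym v≡)
                  (jump (subst (Reach S i) (toℕ-injective (trans (sym f14) (trans f14≡ f18))) reach) j≡
                        (subst (λ x → bit (toℕ x) S ≡ 0) v≡ (trans (sym f21) (trans f21≡ f10))))
                address : f 24 ≡ cellBase + cell (S + p) j v
                address = trans f24 (trans (+-assoc cellBase _ n) (cong (cellBase +_) (cell-next (S + p) v j≡)))
            fail : ¬ AllHold (test eq 21 10 ∷ test eq 14 18 ∷ test eq 11 17 ∷ test lt 19 2 ∷ []) ⟨ f , m ⟩ →
                   Rest ⟨ f , m ⟩
            fail ¬holds = accepts correct complete ext (λ {j} free u≡ v≡ j≡ → contradiction
              ( trans f21 (trans free (sym f10))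
              , trans f14 (trans (cong toℕ u≡) (sym f18))
              , trans f11 (trans (cong toℕ v≡) (sym (f17 j≡)))
              , subst₂ _<_ (trans j≡ (sym f19)) (sym f2) (toℕ<n j)
              , tt) ¬holds)

    runs-inner : ∀ {σ} → Constants σ → reg σ 8 ≡ X → reg σ 11 ≡ toℕ v → reg σ 12 ≡ cell S i u →
      Correct (mem σ) (reg σ 0) → Complete X (mem σ) (reg σ 0) → Runs w inner σ 37 (Processed X)
    runs-inner {σ} consts@(c1 , c2 , c3 , c4 , c5 , c6 , c7 , _ , _) c8 c11 c12 correct complete =
      arith⨾ (toℕ u) c12 c1 (trans (mod-≡ _ n) (block-% Z (toℕ<n u))) (small-word (small-vertex u)) $
      arith⨾ Z c12 c1 (trans (div-≡ _ n) (block-/ Z (toℕ<n u))) (small-word (S-small *ˢ small-k +ˢ i-small)) $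
      arith⨾ (toℕ i) refl c2 (trans (mod-≡ _ k) (block-% S (toℕ<n i))) (small-word i-small) $
      arith⨾ S refl c2 (trans (div-≡ _ k) (block-/ S (toℕ<n i))) (small-word S-small) $
      arith⨾ (2 * toℕ i) c4 refl refl (small-word (small-2 *ˢ i-small)) $
      arith⨾ (2 * toℕ i + 2) refl c4 refl (small-word (small-2 *ˢ i-small +ˢ small-2)) $
      load⨾ (toℕ (s i)) refl (trans (inputs (s-address-< i)) (memory-s i)) (small-word (small-vertex (s i))) $
      const⨾ (small-word (small-const 3 (s≤s (s≤s (s≤s (s≤s (s≤s (s≤s z≤n)))))))) $
      arith⨾ (2 * toℕ i + 5) refl refl refl
        (small-word (small-2 *ˢ i-small +ˢ small-const 3 (s≤s (s≤s (s≤s (s≤s (s≤s (s≤s z≤n)))))))) $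
      load⨾ (m (2 * toℕ i + 5)) refl refl (small-word (small-base (narrow _))) $
      arith⨾ (suc (toℕ i)) refl c3 (+-comm (toℕ i) 1) (small-word (small-≤ (toℕ<n i) small-k)) $
      arith⨾ (tableBase + toℕ v) c6 c11 refl (small-word (small-tableBase +ˢ small-vertex v)) $
      load⨾ p refl (powers (toℕ<n v)) (small-word p-small) $
      arith⨾ (S / p) refl refl (div-≡ S p) (small-word (small-≤ (m/n≤m S p) S-small)) $
      arith⨾ (bit (toℕ v) S) refl c4 (trans (mod-≡ (S / p) 2) (/2^-%2 (toℕ v) S)) (small-word bit-small) $
      arith⨾ (toℕ v * n) c11 c1 refl (small-word (small-vertex v *ˢ small-n)) $
      arith⨾ (toℕ v * n + toℕ u) refl refl refl (small-word (small-vertex v *ˢ small-n +ˢ small-vertex u)) $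
      arith⨾ (matrixBase + (toℕ v * n + toℕ u)) c5 refl refl
        (small-word (small-matrixBase +ˢ (small-vertex v *ˢ small-n +ˢ small-vertex u))) $
      load⨾ (if adj v u then 1 else 0) refl (trans (inputs (adj-address-< v u)) (memory-adj v u))
        (small-word entry-small) $
      arith⨾ (S + p) refl refl refl (small-word (S-small +ˢ p-small)) $
      arith⨾ ((S + p) * k) refl c2 refl (small-word ((S-small +ˢ p-small) *ˢ small-k)) $
      arith⨾ ((S + p) * k + toℕ i) refl refl refl (small-word ((S-small +ˢ p-small) *ˢ small-k +ˢ i-small)) $
      arith⨾ (((S + p) * k + toℕ i) * n) refl c1 refl
        (small-word (((S-small +ˢ p-small) *ˢ small-k +ˢ i-small) *ˢ small-n)) $
      arith⨾ (cell (S + p) i v) refl c11 refl (small-word cell-small) $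
      arith⨾ (cellBase + cell (S + p) i v) c7 refl refl (small-word (small-cellBase +ˢ cell-small)) $
      arith⨾ (cellBase + cell (S + p) i v + n) refl c1 refl (small-word (small-cellBase +ˢ cell-small +ˢ small-n)) $
      runs-marks consts c8 c11 refl next-t refl refl refl refl refl refl correct complete
      where
        open Correct correct
        m = mem σ
        p = 2 ^ toℕ v
        Z = S * k + toℕ i
        instance
          p≢0 : NonZero p
          p≢0 = m^n≢0 2 (toℕ v)
        i-small = small-index i
        S-small : Small 1 S
        S-small = small-mask (<⇒≤ (Reach-< reach))
        p-small : Small 1 p
        p-small = small-mask (^-monoʳ-≤ 2 (<⇒≤ (toℕ<n v)))
        cell-small : Small 6 (cell (S + p) i v)
        cell-small = ((S-small +ˢ p-small) *ˢ small-k +ˢ i-small) *ˢ small-n +ˢ small-vertex v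
        bit-small : Small 1 (bit (toℕ v) S)
        bit-small = small-base (<-≤-trans
          (subst (_< 2) (/2^-%2 (toℕ v) S) (m%n<n (S / p) 2)) 2≤base)
        entry-small : Small 1 (if adj v u then 1 else 0)
        entry-small with adj v u
        ... | true  = small-1
        ... | false = small-≤ z≤n small-1
        next-t : ∀ {j} → toℕ j ≡ suc (toℕ i) → m (2 * toℕ i + 5) ≡ toℕ (t j)
        next-t {j} j≡ = trans (cong m (trans (rearrange (toℕ i)) (cong (λ l → 2 * l + 3) (sym j≡))))
                              (trans (inputs (t-address-< j)) (memory-t j))
          where
            rearrange : ∀ i → 2 * i + 5 ≡ 2 * suc i + 3
            rearrange = solve-∀

  -- If the cell is marked, `sound` supplies the reachable triple for `inner` to work on. The bound
  -- is 4 instructions, a test, 37 steps and the increment.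
  runs-body : ∀ {X σ} → Invariant X σ → X < total → Runs w body σ 43 (Invariant (suc X))
  runs-body {X} {σ} (consts@(c1 , c2 , c3 , c4 , c5 , c6 , c7 , _ , _) , c8 , correct , complete) X<total =
    arith⨾ (toℕ v) c8 c1 (trans (mod-≡ X n) (sym v≡)) (small-word (small-vertex v)) $
    arith⨾ Y c8 c1 (div-≡ X n) (small-word Y-small) $
    arith⨾ (cellBase + Y) c7 refl refl (small-word (small-cellBase +ˢ Y-small)) $
    load⨾ (mem σ (cellBase + Y)) refl refl (small-word (small-base (Correct.narrow correct _))) $
    runs-seq $ runs-map advance $ runs-guarded (test eq 13 3 ∷ [])
      (λ (marked , _) → process (Correct.sound correct Y (trans marked c3)))
      -- By completeness so far, an unmarked cell belongs to no reachable triple, so the round owes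
      -- nothing.
      (λ ¬marked → consts , c8 , correct , complete-suc complete (λ {S} {i} {u} r v′ X≡ →
        contradiction (trans (unread r v′ X≡) (sym c3) , tt) ¬marked))
    where
      Y = X / n
      v : Fin n
      v = fromℕ< (m%n<n X n)
      v≡ : toℕ v ≡ X % n
      v≡ = toℕ-fromℕ< (m%n<n X n)
      X-small : Small 4 X
      X-small = small-≤ (<⇒≤ X<total) small-total
      Y-small : Small 4 Y
      Y-small = small-≤ (m/n≤m X n) X-small

      after : State
      after = setReg 13 (mem σ (cellBase + Y)) (setReg 13 (cellBase + Y) (setReg 12 Y (setReg 11 (toℕ v) σ)))

      process : (∃[ S ] ∃[ i ] ∃[ u ] Reach S i u × Y ≡ cell S i u) → Runs w inner after 37 (Processed X)
      process (S , i , u , r , Y≡) = runs-inner r {X} X≡ consts c8 refl Y≡ correct complete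
        where
          X≡ : cell S i u * n + toℕ v ≡ X
          X≡ = trans (cong₂ (λ y x → y * n + x) (sym Y≡) v≡)
                     (trans (+-comm (Y * n) (X % n)) (sym (m≡m%n+[m/n]*n X n)))

      unread : ∀ {S i u} → Reach S i u → ∀ v′ → cell S i u * n + toℕ v′ ≡ X → Marked (mem σ) Y
      unread {S} {i} {u} r v′ X≡ = subst (Marked (mem σ)) (sym Y≡)
        (reached-marked complete r (subst (cell S i u * n ≤_) X≡ (m≤m+n _ (toℕ v′))))
        where
          Y≡ : Y ≡ cell S i u
          Y≡ = trans (cong (_/ n) (sym X≡)) (block-/ (cell S i u) (toℕ<n v′))

      advance : ∀ {τ} → Processed X τ → Runs w (arith 8 add 8 3) τ 1 (Invariant (suc X))
      advance (consts′@(_ , _ , c3′ , _) , c8′ , correct′ , complete′) =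
        runs-arith (suc X) c8′ c3′ (+-comm X 1) (small-word (small-≤ X<total small-total))
          (consts′ , refl , correct′ , complete′)

  -- Initialisation and the run with at least one pair

  -- `blank` is what makes the table of cells start unmarked at no cost: the words from the first
  -- unfilled power on are still 0.
  record Filled (j : ℕ) (m : ℕ → ℕ) : Set where
    field
      inputs : ∀ {a} → a < tableBase → m a ≡ memory input a
      powers : ∀ {l} → l < j → m (tableBase + l) ≡ 2 ^ l
      narrow : ∀ a → m a < base
      blank  : ∀ {a} → tableBase + j ≤ a → m a ≡ 0

  Filling : ℕ → State → Set
  Filling j σ = (reg σ 0 ≡ 0 × reg σ 1 ≡ n × reg σ 2 ≡ k × reg σ 3 ≡ 1 × reg σ 4 ≡ 2 × reg σ 5 ≡ matrixBase ×
                 reg σ 6 ≡ tableBase × reg σ 7 ≡ cellBase × reg σ 10 ≡ 0) ×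
                reg σ 8 ≡ j × reg σ 9 ≡ 2 ^ j × Filled j (mem σ)

  fill : ∀ {j m} → j < n → Filled j m → Filled (suc j) (m [ tableBase + j ↦ 2 ^ j ])
  fill {j} {m} j<n filled = record
    { inputs = λ a< → trans (update-other m (<⇒≢ (<-≤-trans a< (m≤m+n tableBase j)))) (inputs a<)
    ; powers = powers′
    ; narrow = narrow′
    ; blank  = λ {a} ≤a → let <a = subst (_≤ a) (+-suc tableBase j) ≤a in
                          trans (update-other m (<⇒≢ <a ∘ sym)) (blank (<⇒≤ <a))
    }
    where
      open Filled filled
      m′ = m [ tableBase + j ↦ 2 ^ j ]
      powers′ : ∀ {l} → l < suc j → m′ (tableBase + l) ≡ 2 ^ l
      powers′ {l} l<1+j with l ≟ j
      ... | yes refl = update-same m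
      ... | no l≢j   = trans (update-other m (l≢j ∘ +-cancelˡ-≡ tableBase l j)) (powers (≤∧≢⇒< (≤-pred l<1+j) l≢j))
      narrow′ : ∀ a → m′ a < base
      narrow′ a with a ≟ tableBase + j
      ... | yes refl = subst (_< base) (sym (update-same m)) (^-monoʳ-< 2 (n<1+n 1) (m<n⇒m<1+n j<n))
      ... | no a≢    = subst (_< base) (sym (update-other m a≢)) (narrow a)

  runs-fillTable : ∀ {j σ} → Filling j σ → j < n → Runs w fillTable σ 4 (Filling (suc j))
  runs-fillTable {j} (consts@(_ , _ , _ , c3 , c4 , _ , c6 , _) , c8 , c9 , filled) j<n =
    arith⨾ (tableBase + j) c6 c8 refl (small-word (small-tableBase +ˢ small-≤ (<⇒≤ j<n) small-n)) $
    store⨾ (tableBase + j) (2 ^ j) refl c9 $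
    arith⨾ (2 ^ suc j) c9 c4 (*-comm (2 ^ j) 2) (small-word (small-mask (^-monoʳ-≤ 2 j<n))) $
    runs-arith (suc j) c8 c3 (+-comm j 1) (small-word (small-≤ j<n small-n))
      (consts , refl , refl , fill j<n filled)

  filled-tables : ∀ {m} → Filled n m → Tables m
  filled-tables filled = record { inputs = inputs ; powers = powers ; narrow = narrow }
    where open Filled filled

  filled-correct : ∀ {m} → Filled n m → Correct m 0
  filled-correct filled = record
    { tables = filled-tables filled
    ; sound  = λ Y marked → contradiction (trans (sym marked) (Filled.blank filled (m≤m+n cellBase Y))) λ ()
    ; answer = inj₂ refl
    }

  -- There are 13 single instructions, `total` rounds of 43 steps with a test each, and the final
  -- test.
  runs-markFirst : ∀ {σ} → Filling n σ → Runs w markFirst σ (14 + total * 44) (Invariant total)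
  runs-markFirst {σ} ((c0 , c1 , c2 , c3 , c4 , c5 , c6 , c7 , c10) , _ , c9 , filled) =
    arith⨾ (2 ^ n * k) c9 c2 refl (small-word (mask-small *ˢ small-k)) $
    arith⨾ (2 ^ n * k * n) refl c1 refl (small-word (mask-small *ˢ small-k *ˢ small-n)) $
    arith⨾ total refl c1 refl (small-word small-total) $
    const⨾ (small-word (small-const 2 (s≤s (s≤s (s≤s (s≤s z≤n)))))) $
    load⨾ (toℕ t₀) refl first-t (small-word (small-vertex t₀)) $
    arith⨾ (tableBase + toℕ t₀) c6 refl refl (small-word (small-tableBase +ˢ small-vertex t₀)) $
    load⨾ p refl (powers (toℕ<n t₀)) (small-word p-small) $
    arith⨾ (p * k) refl c2 refl (small-word (p-small *ˢ small-k)) $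
    arith⨾ (p * k * n) refl c1 refl (small-word (p-small *ˢ small-k *ˢ small-n)) $
    arith⨾ (p * k * n + toℕ t₀) refl refl refl (small-word (p-small *ˢ small-k *ˢ small-n +ˢ small-vertex t₀)) $
    arith⨾ (cellBase + (p * k * n + toℕ t₀)) c7 refl refl
      (small-word (small-cellBase +ˢ (p-small *ˢ small-k *ˢ small-n +ˢ small-vertex t₀))) $
    store⨾ (cellBase + cell p i₀ t₀) 1 (cong (cellBase +_) first-cell) c3 $
    const⨾ (small-word (small-const 0 z<s)) $
    runs-for Invariant total
      (λ ((_ , _ , _ , _ , _ , _ , _ , τ9 , _) , τ8 , _) X< → subst₂ _<_ (sym τ8) (sym τ9) X<)
      (λ ((_ , _ , _ , _ , _ , _ , _ , τ9 , _) , τ8 , _) lt′ → <-irrefl refl (subst₂ _<_ τ8 τ9 lt′))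
      runs-body
      ((c1 , c2 , c3 , c4 , c5 , c6 , c7 , refl , c10) , refl
      , subst (Correct m′) (sym c0) (mark-correct (start i₀≡0) refl (filled-correct filled))
      , record
        { first  = λ i≡0 → subst (λ i → Marked m′ (cell (2 ^ toℕ (t i)) i (t i)))
                                 (toℕ-injective (trans i₀≡0 (sym i≡0))) (mark-here {m})
        ; closed = λ _ _ ()
        })
    where
      open Filled filled
      m = mem σ
      i₀ : Fin k
      i₀ = fromℕ< (>-nonZero⁻¹ k)
      i₀≡0 : toℕ i₀ ≡ 0
      i₀≡0 = toℕ-fromℕ< (>-nonZero⁻¹ k)
      t₀ = t i₀
      p = 2 ^ toℕ t₀
      m′ = m [ cellBase + cell p i₀ t₀ ↦ 1 ]
      mask-small : Small 1 (2 ^ n)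
      mask-small = small-mask ≤-refl
      p-small : Small 1 p
      p-small = small-mask (^-monoʳ-≤ 2 (<⇒≤ (toℕ<n t₀)))
      first-t : m 3 ≡ toℕ t₀
      first-t = trans (cong (λ l → m (2 * l + 3)) (sym i₀≡0)) (trans (inputs (t-address-< i₀)) (memory-t i₀))
      first-cell : p * k * n + toℕ t₀ ≡ cell p i₀ t₀
      first-cell = cong (λ a → a * n + toℕ t₀) (sym (trans (cong (p * k +_) i₀≡0) (+-identityʳ (p * k))))

  runs-prepare : ∀ {σ} → reg σ 0 ≡ 0 → reg σ 1 ≡ n → reg σ 2 ≡ k → reg σ 3 ≡ 1 → reg σ 8 ≡ 0 → reg σ 10 ≡ 0 →
                 mem σ ≡ memory input → Runs w prepare σ (22 + n * 5 + total * 44) (Invariant total)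
  runs-prepare c0 c1 c2 c3 c8 c10 refl = weaken (≤-reflexive (rearrange (n * 5) (total * 44))) $
    const⨾ (small-word small-2) $
    arith⨾ (2 * k) refl c2 refl (small-word (small-2 *ˢ small-k)) $
    arith⨾ matrixBase refl refl refl (small-word small-matrixBase) $
    arith⨾ (n * n) c1 c1 refl (small-word (small-n *ˢ small-n)) $
    arith⨾ tableBase refl refl refl (small-word small-tableBase) $
    arith⨾ cellBase refl c1 refl (small-word small-cellBase) $
    const⨾ (small-word small-1) $
    runs-seq $ runs-map runs-markFirst $
    runs-for Filling n
      (λ ((_ , τ1 , _) , τ8 , _) j<n → subst₂ _<_ (sym τ8) (sym τ1) j<n)
      (λ ((_ , τ1 , _) , τ8 , _) lt′ → <-irrefl refl (subst₂ _<_ τ8 τ1 lt′))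
      runs-fillTable
      ((c0 , c1 , c2 , c3 , refl , refl , refl , refl , c10) , c8 , refl , record
        { inputs = λ _ → refl
        ; powers = λ ()
        ; narrow = λ a → <-≤-trans (memory-input-< (>-nonZero⁻¹ n) a) (<⇒≤ (n<2^n (suc n)))
        ; blank  = λ {a} ≤a → memory-beyond input
            (subst (_≤ a) (trans (+-identityʳ tableBase) (sym length-input)) ≤a)
        })
    where
      rearrange : ∀ a b → 7 + (suc a + (14 + b)) ≡ 22 + a + b
      rearrange = solve-∀

  -- An answer 1 comes with an accepting triple. Against an answer 0, disjoint paths would give such
  -- a triple, and its rounds all lie below `total`, so one of them has set the register to 1.
  invariant⇒answers : ∀ {σ} → Invariant total σ → Answers (HasDisjointPaths I) σ
  invariant⇒answers (_ , _ , correct , complete) with Correct.answer correct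
  ... | inj₁ (yes≡ , accepting) = inj₁ (yes≡ , accepting⇒paths accepting)
  ... | inj₂ no≡ = inj₂ (no≡ , λ paths → refute (paths⇒accepting paths))
    where
      refute : ¬ Accepting
      refute (S , i , 1+i≡k , r)
        -- Acceptance is tested in every round of the triple; `s i` is merely a vertex at hand to
        -- name one of them.
        with trans (sym no≡) (Closed.by-accept (Complete.closed complete r (s i) (cell-total (s i) r)) refl 1+i≡k)
      ... | ()

-- Total running time and the case without pairs

module _ (I : DisjointPathsInstance) where
  open DisjointPathsInstance I
  open Layout I
  open Bounds n

  no-pairs : k ≡ 0 → HasDisjointPaths I
  no-pairs k≡0 = (λ i → contradiction i none) , λ i → contradiction i none
    where
      none : ¬ Fin k
      none i = n≮0 (subst (toℕ i <_) k≡0 (toℕ<n i))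

  time : ℕ
  time = 2 ^ n * n ^ 2 * k

  -- The constant is 26 + 5 + 44: the fixed steps are charged to 1, and the table of powers is paid
  -- by `n ≤ total`, which uses that `k` is positive.
  time-bound : k ≢ 0 → 4 + (22 + n * 5 + 2 ^ n * k * n * n * 44) ≤ 75 * (1 ⊔ time)
  time-bound k≢0 = begin
    4 + (22 + n * 5 + total * 44)
      ≤⟨ +-monoʳ-≤ 4 (+-mono-≤ (+-monoʳ-≤ 22 (*-monoˡ-≤ 5 n≤)) (*-monoˡ-≤ 44 total≤)) ⟩
    4 + (22 + b * 5 + b * 44)           ≡⟨ rearrange₁ b ⟩
    26 * 1 + 49 * b                     ≤⟨ +-monoˡ-≤ (49 * b) (*-monoʳ-≤ 26 (m≤m⊔n 1 time)) ⟩
    26 * b + 49 * b                     ≡⟨ rearrange₂ b ⟩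
    75 * b                              ∎
    where
      open ≤-Reasoning
      instance
        nonZero-k : NonZero k
        nonZero-k = ≢-nonZero k≢0
        nonZero-n : NonZero n
        nonZero-n = >-nonZero (≤-trans (>-nonZero⁻¹ k) k≤n)
        nonZero-p : NonZero (2 ^ n * k * n)
        nonZero-p = m*n≢0 (2 ^ n * k) n {{m*n≢0 (2 ^ n) k {{m^n≢0 2 n}}}}
      total = 2 ^ n * k * n * n
      b = 1 ⊔ time
      rearrange₁ : ∀ b → 4 + (22 + b * 5 + b * 44) ≡ 26 * 1 + 49 * b
      rearrange₁ = solve-∀
      rearrange₂ : ∀ b → 26 * b + 49 * b ≡ 75 * b
      rearrange₂ = solve-∀
      reorder : ∀ p k n → p * k * n * n ≡ p * (n * (n * 1)) * k
      reorder = solve-∀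
      total≤ : total ≤ b
      total≤ = ≤-trans (≤-reflexive (reorder (2 ^ n) k n)) (m≤n⊔m 1 time)
      n≤ : n ≤ b
      n≤ = ≤-trans (m≤n*m n (2 ^ n * k * n)) total≤

  runs-program : ∀ {t Q} → let σ = setReg 2 k (setReg 3 1 (setReg 1 n (initial input))) in
                 (k ≡ 0 → Runs w (const 0 1) σ t Q) → (k ≢ 0 → Runs w prepare σ t Q) →
                 Runs w program (initial input) (4 + t) Q
  runs-program when-0 when-≢0 =
    load⨾ n refl refl (small-word small-n) $
    const⨾ (small-word small-1) $
    load⨾ k refl refl (small-word (small-≤ k≤n small-n)) $
    runs-if {b = test eq 2 0} when-0 when-≢0

  program-solves : Runs w program (initial input) (75 * (1 ⊔ time)) (Answers (HasDisjointPaths I))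
  program-solves with k ≟ 0
  -- Here `time` is 0; the run consists of three instructions, the test and the answer, 5 steps in
  -- all.
  ... | yes k≡0 = weaken (≤-trans (m≤m+n 5 70) (*-monoʳ-≤ 75 (m≤m⊔n 1 time))) $ runs-program
    (λ _ → runs-const (small-word small-1) (inj₁ (refl , no-pairs k≡0)))
    (λ k≢0 → contradiction k≡0 k≢0)
  ... | no k≢0 = weaken (time-bound k≢0) $ runs-program
    (λ k≡0 → contradiction k≡0 k≢0)
    (λ _ → runs-map (λ {τ} → invariant⇒answers {τ}) (runs-prepare refl refl refl refl refl refl refl))
    where
      instance
        nonZero-k : NonZero k
        nonZero-k = ≢-nonZero k≢0
      open Verification I

open DisjointPathsInstance using (n; k)

theorem6p1 : SolvableInTimeO DisjointPaths (λ I → 2 ^ n I * n I ^ 2 * k I)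
theorem6p1 = program , wordFactor , 75 , program-solves
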